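{- Let $f:\{0,1\}^n\to\{0,1\}$ be a total function. Then $\mathrm{R}_0(f)=O(\mathrm{RS}(f)^2\log\mathrm{RS}(f))$, or alternately, $\mathrm{RS}(f)=\Omega\big(\sqrt{\mathrm{R}_0(f)/\log\mathrm{R}_0(f)}\big)$.
   Context: A randomized query algorithm is a probability distribution over deterministic decision trees; $\mathrm{R}_0(h)$ is the minimum, over randomized algorithms always correct on every input in the domain of $h$, of the maximum over inputs of the expected number of queries. Query notions apply to alphabet $\{0,1,*,\dagger\}$. Sabotage: $P_f\subseteq\{0,1,*\}^n$ is the set of $p$ for which there exist $x,y\in\{0,1\}^n$ with $f(x)\ne f(y)$ and $x_i=y_i=p_i$ whenever $p_i\ne*$; $P_f^\dagger$ is the same with $\dagger$ in place of $*$; $Q_f=P_f\cup P_f^\dagger$; $f_{\mathrm{sab}}:Q_f\to\{0,1\}$ is $0$ on $P_f$ and $1$ on $P_f^\dagger$; $\mathrm{RS}(f)=\mathrm{R}_0(f_{\mathrm{sab}})$.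
   Formalization: Probabilities in the randomized query algorithms, and the upper bounds on the expected number of queries, are rational rather than real. -}

module Defs where

open import Data.Bool using (Bool; true; false)
open import Data.Nat using (ℕ; zero; suc)
import Data.Nat as ℕ
open import Data.Nat.Logarithm using (⌈log₂_⌉)
open import Data.Integer using (ℤ; +_; ∣_∣)
open import Data.Fin using (Fin)
open import Data.Vec using (Vec; lookup)
open import Data.List using (List; []; _∷_)
open import Data.List.Relation.Unary.All using (All)
open import Data.Product using (_×_; _,_; ∃; ∃₂; proj₁; proj₂)
open import Data.Sum using (_⊎_)
open import Data.Rational using (ℚ; _+_; _*_; _≤_; 0ℚ; 1ℚ; _/_; ceiling)
open import Relation.Binary.PropositionalEquality using (_≡_; _≢_)
open import Relation.Nullary using (¬_)

data Σ₄ : Set where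
  b0 b1 star dagger : Σ₄

fromBool : Bool → Σ₄
fromBool false = b0
fromBool true  = b1

data DTree (A : Set) (n : ℕ) : Set where
  leaf  : Bool → DTree A n
  query : Fin n → (A → DTree A n) → DTree A n

eval : ∀ {A n} → DTree A n → Vec A n → Bool
eval (leaf b)    x = b
eval (query i k) x = eval (k (lookup x i)) x

cost : ∀ {A n} → DTree A n → Vec A n → ℕ
cost (leaf b)    x = 0
cost (query i k) x = suc (cost (k (lookup x i)) x)

RandAlg : Set → ℕ → Set
RandAlg A n = List (ℚ × DTree A n)

ℕtoℚ : ℕ → ℚ
ℕtoℚ m = (+ m) / 1

totalWeight : ∀ {A n} → RandAlg A n → ℚ
totalWeight []             = 0ℚ
totalWeight ((w , _) ∷ ps) = w + totalWeight ps

expCost : ∀ {A n} → RandAlg A n → Vec A n → ℚ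
expCost []             x = 0ℚ
expCost ((w , T) ∷ ps) x = w * ℕtoℚ (cost T x) + expCost ps x

IsDistribution : ∀ {A n} → RandAlg A n → Set
IsDistribution R = All (λ p → 0ℚ ≤ proj₁ p) R × totalWeight R ≡ 1ℚ

-- A (partial) function h on Vec A n is given as a relation
-- Spec x b  :=  "x is in the domain of h and h x = b".
Spec : Set → ℕ → Set₁
Spec A n = Vec A n → Bool → Set

ZeroError : ∀ {A n} → Spec A n → RandAlg A n → Set
ZeroError h R = All (λ p → ∀ x b → h x b → eval (proj₂ p) x ≡ b) R

-- R is a zero-error randomized algorithm for h whose worst-case
-- expected number of queries (over the domain) is at most r.
-- R₀(h) ≤ r  iff such an algorithm exists.
ZeroErrorAlgWithin : ∀ {A n} → Spec A n → RandAlg A n → ℚ → Set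
ZeroErrorAlgWithin h R r =
  IsDistribution R × ZeroError h R × (∀ x b → h x b → expCost R x ≤ r)

totalSpec : ∀ {n} → (Vec Bool n → Bool) → Spec Bool n
totalSpec f x b = f x ≡ b

Consistent : ∀ {n} → Σ₄ → Vec Σ₄ n → Vec Bool n → Set
Consistent {n} c p x = ∀ (i : Fin n) → lookup p i ≢ c → fromBool (lookup x i) ≡ lookup p i

OnlyUses : ∀ {n} → Σ₄ → Vec Σ₄ n → Set
OnlyUses {n} c p = ∀ (i : Fin n) → lookup p i ≡ b0 ⊎ lookup p i ≡ b1 ⊎ lookup p i ≡ c

SabSet : ∀ {n} → (Vec Bool n → Bool) → Σ₄ → Vec Σ₄ n → Set
SabSet f c p = OnlyUses c p ×
  ∃₂ λ x y → f x ≢ f y × Consistent c p x × Consistent c p y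

P_ : ∀ {n} → (Vec Bool n → Bool) → Vec Σ₄ n → Set
P_ f = SabSet f star

P† : ∀ {n} → (Vec Bool n → Bool) → Vec Σ₄ n → Set
P† f = SabSet f dagger

sabSpec : ∀ {n} → (Vec Bool n → Bool) → Spec Σ₄ n
sabSpec f p b = (b ≡ false × P_ f p) ⊎ (b ≡ true × P† f p)

-- The bound  r² · (1 + ⌈log₂ ⌈r⌉⌉)  (log with the usual "+1" convention)

r²logr : ℚ → ℚ
r²logr r = r * r * ℕtoℚ (suc ⌈log₂ ∣ ceiling r ∣ ⌉)

{-# OPTIONS --safe #-}
module Submission where

-- If f x ≢ f z, put * (respectively †) where x and z differ: to tell the two sabotaged inputs apart, a run of the
-- sabotage algorithm must query such a position, and until it does it coincides with a run on x. By Markov's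
-- inequality the run on x, cut off after 2⌈r⌉ queries, therefore hits the difference with probability at least ½.
-- Repeat these cut-off runs on the true input x until the answers form a certificate. Every position of a minimal
-- sensitive block is sensitive at the flipped input, so such blocks have size at most 4⌈r⌉; tracing a block position
-- by position through runs on successively flipped inputs shows that there are at most (4⌈r⌉)^(4⌈r⌉) of them. Each
-- run halves the expected number of blocks still unhit, so O(r log r) runs of O(r) queries suffice on average. The
-- count of unhit blocks is replaced by a weighted version, which needs no enumeration of minimal blocks.

open import Defs
open import Data.Bool using (Bool; true; false; if_then_else_; not)
import Data.Bool.Properties as Bool
open import Data.Fin using (Fin; zero; suc)
import Data.Fin.Properties as Fin
open import Data.Integer using (ℤ; +_; ∣_∣)
import Data.Integer as ℤ
import Data.Integer.DivMod as ℤ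
import Data.Integer.Properties as ℤ
open import Data.Integer.Tactic.RingSolver using () renaming (solve-∀ to ℤ-solve-∀)
open import Data.List using (List; []; _∷_; _++_; map; length)
open import Data.List.Properties using (map-++)
open import Data.List.Relation.Unary.All as All using (All; []; _∷_)
import Data.List.Relation.Unary.All.Properties as All
open import Data.Maybe using (nothing)
open import Data.Nat using (ℕ; zero; suc; z≤n; s≤s)
import Data.Nat as ℕ
import Data.Nat.Properties as ℕ
open import Data.Nat.Induction using (Acc; acc; <-wellFounded)
open import Data.Nat.Logarithm using (⌈log₂_⌉)
open import Data.Nat.Logarithm.Core using (⌈log2⌉)
open import Data.Nat.Tactic.RingSolver using () renaming (solve-∀ to ℕ-solve-∀)
open import Data.Product using (∃; _×_; _,_; proj₁; proj₂; map₂)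
open import Data.Rational
  using (ℚ; mkℚ; _+_; _*_; _-_; -_; _≤_; 0ℚ; 1ℚ; ½; ceiling; floor; ↥_; ↧_; nonNegative; toℚᵘ)
open import Data.Rational.Properties
  using (≤-refl; ≤-reflexive; ≤-trans; ≤-total; +-mono-≤; +-monoˡ-≤; +-monoʳ-≤; *-monoˡ-≤-nonNeg; *-monoʳ-≤-nonNeg;
         *-cancelˡ-≤-pos; neg-antimono-≤; +-identityˡ; +-identityʳ; +-assoc; +-comm; *-identityˡ; *-identityʳ; *-zeroʳ;
         *-comm; *-distribˡ-+; *-distribʳ-+; +-*-commutativeRing; normalize-nonNeg; normalize-pos; nonNegative⁻¹;
         toℚᵘ-injective; toℚᵘ-homo-+; toℚᵘ-homo-*; toℚᵘ-fromℚᵘ; toℚᵘ-mono-≤; toℚᵘ-cancel-≤; drop-*≤*;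
         ↥-neg; ↧-neg; ↥ᵘ-toℚᵘ; ↧ᵘ-toℚᵘ; module ≤-Reasoning)
import Data.Rational.Unnormalised as ℚᵘ
import Data.Rational.Unnormalised.Properties as ℚᵘ
open import Data.Sum using (_⊎_; inj₁; inj₂)
open import Data.Vec using (Vec; []; _∷_; lookup; tabulate; replicate; _[_]%=_)
open import Data.Vec.Properties using (lookup∘tabulate; lookup∘updateAt′)
open import Function using (_∘_; const; case_of_)
open import Relation.Binary.PropositionalEquality
  using (_≡_; _≢_; refl; sym; trans; cong; cong₂; subst; subst₂; module ≡-Reasoning)
open import Relation.Nullary using (¬_; Dec; yes; no; does; contradiction; ¬?; _×-dec_; _⊎-dec_)
open import Relation.Nullary.Decidable using (map′; decidable-stable)
open import Tactic.RingSolver using (solve-∀)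
open import Tactic.RingSolver.Core.AlmostCommutativeRing using (AlmostCommutativeRing; fromCommutativeRing)

-- Rational arithmetic, the embedding of the naturals, indicators

ℚ-ring : AlmostCommutativeRing _ _
ℚ-ring = fromCommutativeRing +-*-commutativeRing (λ _ → nothing)

toℚᵘ-ℕtoℚ : ∀ a → toℚᵘ (ℕtoℚ a) ℚᵘ.≃ ℚᵘ.mkℚᵘ (+ a) 0
toℚᵘ-ℕtoℚ a = toℚᵘ-fromℚᵘ (ℚᵘ.mkℚᵘ (+ a) 0)

ℕtoℚ-+ : ∀ a b → ℕtoℚ (a ℕ.+ b) ≡ ℕtoℚ a + ℕtoℚ b
ℕtoℚ-+ a b = toℚᵘ-injective (begin
  toℚᵘ (ℕtoℚ (a ℕ.+ b))                     ≈⟨ toℚᵘ-ℕtoℚ _ ⟩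
  ℚᵘ.mkℚᵘ (+ (a ℕ.+ b)) 0                   ≈⟨ ℚᵘ.*≡* (cong (ℤ._* + 1) (cong₂ ℤ._+_ (sym (ℤ.*-identityʳ (+ a))) (sym (ℤ.*-identityʳ (+ b))))) ⟩
  ℚᵘ.mkℚᵘ (+ a) 0 ℚᵘ.+ ℚᵘ.mkℚᵘ (+ b) 0      ≈⟨ ℚᵘ.+-cong (toℚᵘ-ℕtoℚ a) (toℚᵘ-ℕtoℚ b) ⟨
  toℚᵘ (ℕtoℚ a) ℚᵘ.+ toℚᵘ (ℕtoℚ b)          ≈⟨ toℚᵘ-homo-+ (ℕtoℚ a) (ℕtoℚ b) ⟨
  toℚᵘ (ℕtoℚ a + ℕtoℚ b)                    ∎)
  where open ℚᵘ.≃-Reasoning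

ℕtoℚ-* : ∀ a b → ℕtoℚ (a ℕ.* b) ≡ ℕtoℚ a * ℕtoℚ b
ℕtoℚ-* a b = toℚᵘ-injective (begin
  toℚᵘ (ℕtoℚ (a ℕ.* b))                     ≈⟨ toℚᵘ-ℕtoℚ _ ⟩
  ℚᵘ.mkℚᵘ (+ (a ℕ.* b)) 0                   ≈⟨ ℚᵘ.*≡* (cong (ℤ._* + 1) (ℤ.pos-* a b)) ⟩
  ℚᵘ.mkℚᵘ (+ a) 0 ℚᵘ.* ℚᵘ.mkℚᵘ (+ b) 0      ≈⟨ ℚᵘ.*-cong (toℚᵘ-ℕtoℚ a) (toℚᵘ-ℕtoℚ b) ⟨
  toℚᵘ (ℕtoℚ a) ℚᵘ.* toℚᵘ (ℕtoℚ b)          ≈⟨ toℚᵘ-homo-* (ℕtoℚ a) (ℕtoℚ b) ⟨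
  toℚᵘ (ℕtoℚ a * ℕtoℚ b)                    ∎)
  where open ℚᵘ.≃-Reasoning

0≤ℕtoℚ : ∀ a → 0ℚ ≤ ℕtoℚ a
0≤ℕtoℚ a = nonNegative⁻¹ (ℕtoℚ a) {{normalize-nonNeg a 1}}

*-monoˡ : ∀ {p q r} → 0ℚ ≤ r → p ≤ q → r * p ≤ r * q
*-monoˡ {r = r} 0≤r = *-monoˡ-≤-nonNeg r {{nonNegative 0≤r}}

*-monoʳ : ∀ {p q r} → 0ℚ ≤ r → p ≤ q → p * r ≤ q * r
*-monoʳ {r = r} 0≤r = *-monoʳ-≤-nonNeg r {{nonNegative 0≤r}}

0≤+ : ∀ {p q} → 0ℚ ≤ p → 0ℚ ≤ q → 0ℚ ≤ p + q
0≤+ = +-mono-≤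

0≤* : ∀ {p q} → 0ℚ ≤ p → 0ℚ ≤ q → 0ℚ ≤ p * q
0≤* {p} 0≤p 0≤q = ≤-trans (≤-reflexive (sym (*-zeroʳ p))) (*-monoˡ 0≤p 0≤q)

p≤p+q : ∀ {p q} → 0ℚ ≤ q → p ≤ p + q
p≤p+q {p} 0≤q = ≤-trans (≤-reflexive (sym (+-identityʳ p))) (+-monoʳ-≤ p 0≤q)

p≤q+p : ∀ {p q} → 0ℚ ≤ q → p ≤ q + p
p≤q+p {p} {q} 0≤q = ≤-trans (p≤p+q 0≤q) (≤-reflexive (+-comm p q))

ℕtoℚ-mono : ∀ {a b} → a ℕ.≤ b → ℕtoℚ a ≤ ℕtoℚ b
ℕtoℚ-mono {a} {b} a≤b = ≤-trans (p≤p+q (0≤ℕtoℚ (b ℕ.∸ a)))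
  (≤-reflexive (trans (sym (ℕtoℚ-+ a (b ℕ.∸ a))) (cong ℕtoℚ (ℕ.m+[n∸m]≡n a≤b))))

ℕtoℚ-cancel-≤ : ∀ {a b} → ℕtoℚ a ≤ ℕtoℚ b → a ℕ.≤ b
ℕtoℚ-cancel-≤ {a} {b} le with ℚᵘ.≤-respˡ-≃ (toℚᵘ-ℕtoℚ a) (ℚᵘ.≤-respʳ-≃ (toℚᵘ-ℕtoℚ b) (toℚᵘ-mono-≤ le))
... | ℚᵘ.*≤* p = ℤ.drop‿+≤+ (subst₂ ℤ._≤_ (ℤ.*-identityʳ (+ a)) (ℤ.*-identityʳ (+ b)) p)

0≤1 : 0ℚ ≤ 1ℚ
0≤1 = 0≤ℕtoℚ 1

0≤½ : 0ℚ ≤ ½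
0≤½ = nonNegative⁻¹ ½

ind : ∀ {P : Set} → Dec P → ℚ
ind P? = if does P? then 1ℚ else 0ℚ

0≤ind : ∀ {P : Set} (P? : Dec P) → 0ℚ ≤ ind P?
0≤ind (yes _) = 0≤1
0≤ind (no  _) = ≤-refl

ind-yes : ∀ {P : Set} (P? : Dec P) → P → ind P? ≡ 1ℚ
ind-yes (yes _) _ = refl
ind-yes (no ¬p) p = contradiction p ¬p

ind-no : ∀ {P : Set} (P? : Dec P) → ¬ P → ind P? ≡ 0ℚ
ind-no (yes p) ¬p = contradiction p ¬p
ind-no (no _)  _  = refl

ind≤1 : ∀ {P : Set} (P? : Dec P) → ind P? ≤ 1ℚ
ind≤1 (yes _) = ≤-refl
ind≤1 (no  _) = 0≤1

ind-mono : ∀ {P Q : Set} (P? : Dec P) (Q? : Dec Q) → (P → Q) → ind P? ≤ ind Q?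
ind-mono (no _)  Q? imp = 0≤ind Q?
ind-mono (yes p) Q? imp = ≤-reflexive (sym (ind-yes Q? (imp p)))

private variable
  A B : Set

-- Finitely supported measures

Measure : Set → Set
Measure A = List (ℚ × A)

NonNeg : Measure A → Set
NonNeg = All (λ p → 0ℚ ≤ proj₁ p)

expect : Measure A → (A → ℚ) → ℚ
expect []            g = 0ℚ
expect ((w , a) ∷ μ) g = w * g a + expect μ g

dirac : A → Measure A
dirac a = (1ℚ , a) ∷ []

weigh : ℚ → List A → Measure A
weigh c = map (c ,_)

scale : ℚ → Measure A → Measure A
scale c = map (λ (w , a) → c * w , a)

infixl 1 _>>=_
_>>=_ : Measure A → (A → Measure B) → Measure B
[]            >>= k = []
((w , a) ∷ μ) >>= k = scale w (k a) ++ (μ >>= k)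

expect-cong : ∀ (μ : Measure A) {g h} → (∀ a → g a ≡ h a) → expect μ g ≡ expect μ h
expect-cong []            eq = refl
expect-cong ((w , a) ∷ μ) eq = cong₂ (λ p q → w * p + q) (eq a) (expect-cong μ eq)

expect-monoᴬ : ∀ {μ : Measure A} {g h} → NonNeg μ → All (λ p → g (proj₂ p) ≤ h (proj₂ p)) μ → expect μ g ≤ expect μ h
expect-monoᴬ []        []         = ≤-refl
expect-monoᴬ (0≤w ∷ 0≤μ) (p ∷ ps) = +-mono-≤ (*-monoˡ 0≤w p) (expect-monoᴬ 0≤μ ps)

expect-mono : ∀ {μ : Measure A} {g h} → NonNeg μ → (∀ a → g a ≤ h a) → expect μ g ≤ expect μ h
expect-mono {μ = μ} 0≤μ g≤h = expect-monoᴬ 0≤μ (All.universal (λ p → g≤h (proj₂ p)) μ)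

expect-zero : ∀ (μ : Measure A) → expect μ (const 0ℚ) ≡ 0ℚ
expect-zero []            = refl
expect-zero ((w , a) ∷ μ) = trans (cong₂ _+_ (*-zeroʳ w) (expect-zero μ)) (+-identityˡ 0ℚ)

expect-nonNeg : ∀ {μ : Measure A} {g} → NonNeg μ → (∀ a → 0ℚ ≤ g a) → 0ℚ ≤ expect μ g
expect-nonNeg {μ = μ} 0≤μ 0≤g = ≤-trans (≤-reflexive (sym (expect-zero μ))) (expect-mono 0≤μ 0≤g)

expect-+ : ∀ (μ : Measure A) g h → expect μ (λ a → g a + h a) ≡ expect μ g + expect μ h
expect-+ []            g h = sym (+-identityˡ 0ℚ)
expect-+ ((w , a) ∷ μ) g h =
  trans (cong (_+_ (w * (g a + h a))) (expect-+ μ g h)) (lemma w (g a) (h a) (expect μ g) (expect μ h))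
  where
  lemma : ∀ w a b c d → w * (a + b) + (c + d) ≡ (w * a + c) + (w * b + d)
  lemma = solve-∀ ℚ-ring

expect-* : ∀ (μ : Measure A) c g → expect μ (λ a → c * g a) ≡ c * expect μ g
expect-* []            c g = sym (*-zeroʳ c)
expect-* ((w , a) ∷ μ) c g =
  trans (cong (_+_ (w * (c * g a))) (expect-* μ c g)) (lemma w c (g a) (expect μ g))
  where
  lemma : ∀ w c a b → w * (c * a) + c * b ≡ c * (w * a + b)
  lemma = solve-∀ ℚ-ring

expect-const : ∀ (μ : Measure A) c → expect μ (const c) ≡ c * expect μ (const 1ℚ)
expect-const μ c = trans (expect-cong μ (λ _ → sym (*-identityʳ c))) (expect-* μ c (const 1ℚ))

expect-dirac : ∀ (a : A) g → expect (dirac a) g ≡ g a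
expect-dirac a g = trans (+-identityʳ _) (*-identityˡ (g a))

expect-scale : ∀ c (μ : Measure A) g → expect (scale c μ) g ≡ c * expect μ g
expect-scale c []            g = sym (*-zeroʳ c)
expect-scale c ((w , a) ∷ μ) g =
  trans (cong (_+_ (c * w * g a)) (expect-scale c μ g)) (lemma c w (g a) (expect μ g))
  where
  lemma : ∀ c w a b → c * w * a + c * b ≡ c * (w * a + b)
  lemma = solve-∀ ℚ-ring

expect-++ : ∀ (μ ν : Measure A) g → expect (μ ++ ν) g ≡ expect μ g + expect ν g
expect-++ []            ν g = sym (+-identityˡ _)
expect-++ ((w , a) ∷ μ) ν g =
  trans (cong (_+_ (w * g a)) (expect-++ μ ν g)) (sym (+-assoc (w * g a) (expect μ g) (expect ν g)))

expect->>= : ∀ (μ : Measure A) (k : A → Measure B) g → expect (μ >>= k) g ≡ expect μ (λ a → expect (k a) g)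
expect->>= []            k g = refl
expect->>= ((w , a) ∷ μ) k g =
  trans (expect-++ (scale w (k a)) (μ >>= k) g) (cong₂ _+_ (expect-scale w (k a) g) (expect->>= μ k g))

expect-map : ∀ (φ : A → B) (μ : Measure A) g → expect (map (map₂ φ) μ) g ≡ expect μ (g ∘ φ)
expect-map φ []            g = refl
expect-map φ ((w , a) ∷ μ) g = cong (_+_ (w * g (φ a))) (expect-map φ μ g)

expect-swap : ∀ (μ : Measure A) (ν : Measure B) (g : A → B → ℚ) →
  expect μ (λ a → expect ν (g a)) ≡ expect ν (λ b → expect μ (λ a → g a b))
expect-swap []            ν g = sym (expect-zero ν)
expect-swap ((w , a) ∷ μ) ν g = begin
  w * expect ν (g a) + expect μ (λ a′ → expect ν (g a′))
    ≡⟨ cong₂ _+_ (sym (expect-* ν w (g a))) (expect-swap μ ν g) ⟩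
  expect ν (λ b → w * g a b) + expect ν (λ b → expect μ (λ a′ → g a′ b))
    ≡⟨ expect-+ ν _ _ ⟨
  expect ν (λ b → w * g a b + expect μ (λ a′ → g a′ b)) ∎
  where open ≡-Reasoning

scale-nonNeg : ∀ {c} {μ : Measure A} → 0ℚ ≤ c → NonNeg μ → NonNeg (scale c μ)
scale-nonNeg 0≤c 0≤μ = All.map⁺ (All.map (0≤* 0≤c) 0≤μ)

weigh-nonNeg : ∀ {c} → 0ℚ ≤ c → (xs : List A) → NonNeg (weigh c xs)
weigh-nonNeg 0≤c xs = All.map⁺ (All.universal (const 0≤c) xs)

>>=-nonNeg : ∀ {μ : Measure A} {k : A → Measure B} → NonNeg μ → (∀ a → NonNeg (k a)) → NonNeg (μ >>= k)
>>=-nonNeg []          0≤k = []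
>>=-nonNeg (0≤w ∷ 0≤μ) 0≤k = All.++⁺ (scale-nonNeg 0≤w (0≤k _)) (>>=-nonNeg 0≤μ 0≤k)

totalWeight-expect : ∀ {n} (μ : RandAlg A n) → totalWeight μ ≡ expect μ (const 1ℚ)
totalWeight-expect []            = refl
totalWeight-expect ((w , T) ∷ μ) = cong₂ _+_ (sym (*-identityʳ w)) (totalWeight-expect μ)

expCost-expect : ∀ {n} (μ : RandAlg A n) x → expCost μ x ≡ expect μ (λ T → ℕtoℚ (cost T x))
expCost-expect []            x = refl
expCost-expect ((w , T) ∷ μ) x = cong (_+_ (w * ℕtoℚ (cost T x))) (expCost-expect μ x)

expect-weigh : ∀ c (xs : List A) → expect (weigh c xs) (const 1ℚ) ≡ c * ℕtoℚ (length xs)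
expect-weigh c []       = sym (*-zeroʳ c)
expect-weigh c (x ∷ xs) = begin
  c * 1ℚ + expect (weigh c xs) (const 1ℚ)   ≡⟨ cong (_+_ (c * 1ℚ)) (expect-weigh c xs) ⟩
  c * 1ℚ + c * ℕtoℚ (length xs)             ≡⟨ *-distribˡ-+ c 1ℚ _ ⟨
  c * (1ℚ + ℕtoℚ (length xs))               ≡⟨ cong (c *_) (ℕtoℚ-+ 1 (length xs)) ⟨
  c * ℕtoℚ (suc (length xs))                ∎
  where open ≡-Reasoning

-- Truncated runs

-- The tree reads letters of `Σ₄` but is fed only the Boolean bits of `x`. Its output is dropped,
-- since only the positions touched by the first `m` queries matter.
queried : ∀ {n} → ℕ → DTree Σ₄ n → Vec Bool n → List (Fin n)
queried zero    _           x = []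
queried (suc m) (leaf _)    x = []
queried (suc m) (query i k) x = i ∷ queried m (k (fromBool (lookup x i))) x

length-queried : ∀ {n} m (T : DTree Σ₄ n) x → length (queried m T x) ℕ.≤ m
length-queried zero    T           x = z≤n
length-queried (suc m) (leaf _)    x = z≤n
length-queried (suc m) (query i k) x = s≤s (length-queried m _ x)

Agree : ∀ {n} → Vec Bool n → Vec Bool n → List (Fin n) → Set
Agree x z = All (λ i → lookup z i ≡ lookup x i)

agree? : ∀ {n} (x z : Vec Bool n) Q → Dec (Agree x z Q)
agree? x z = All.all? (λ i → lookup z i Bool.≟ lookup x i)

mask : ∀ {n} → Σ₄ → Vec Bool n → Vec Bool n → Vec Σ₄ n
mask c x z = tabulate (λ i → if does (lookup z i Bool.≟ lookup x i) then fromBool (lookup x i) else c)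

lookup-mask : ∀ {n} c (x z : Vec Bool n) i →
  (lookup z i ≡ lookup x i × lookup (mask c x z) i ≡ fromBool (lookup x i)) ⊎
  (lookup z i ≢ lookup x i × lookup (mask c x z) i ≡ c)
lookup-mask c x z i rewrite lookup∘tabulate
  (λ i → if does (lookup z i Bool.≟ lookup x i) then fromBool (lookup x i) else c) i
  with lookup z i Bool.≟ lookup x i
... | yes eq = inj₁ (eq , refl)
... | no neq = inj₂ (neq , refl)

mask-agree : ∀ {n} c (x z : Vec Bool n) i → lookup z i ≡ lookup x i → lookup (mask c x z) i ≡ fromBool (lookup x i)
mask-agree c x z i eq with lookup-mask c x z i
... | inj₁ (_ , p)   = p
... | inj₂ (neq , _) = contradiction eq neq

mask-SabSet : ∀ {n} (f : Vec Bool n → Bool) c {x z} → f x ≢ f z → SabSet f c (mask c x z)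
mask-SabSet f c {x} {z} fx≢fz = onlyUses , x , z , fx≢fz , consistentˡ , consistentʳ
  where
  bits : ∀ b → fromBool b ≡ b0 ⊎ fromBool b ≡ b1
  bits false = inj₁ refl
  bits true  = inj₂ refl

  onlyUses : OnlyUses c (mask c x z)
  onlyUses i with lookup-mask c x z i
  ... | inj₂ (_ , p) = inj₂ (inj₂ p)
  ... | inj₁ (_ , p) with bits (lookup x i)
  ...   | inj₁ q = inj₁ (trans p q)
  ...   | inj₂ q = inj₂ (inj₁ (trans p q))

  consistentˡ : Consistent c (mask c x z) x
  consistentˡ i ≢c with lookup-mask c x z i
  ... | inj₁ (_ , p) = sym p
  ... | inj₂ (_ , p) = contradiction p ≢c

  consistentʳ : Consistent c (mask c x z) z
  consistentʳ i ≢c with lookup-mask c x z i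
  ... | inj₁ (eq , p) = trans (cong fromBool eq) (sym p)
  ... | inj₂ (_ , p)  = contradiction p ≢c

-- As long as a run on x stays where x and z agree, it is also a run on both masked inputs.
queried-masked : ∀ {n} m (T : DTree Σ₄ n) x z → Agree x z (queried m T x) →
  eval T (mask star x z) ≢ eval T (mask dagger x z) → m ℕ.≤ cost T (mask star x z)
queried-masked zero    T           x z _          _  = z≤n
queried-masked (suc m) (leaf _)    x z _          ne = contradiction refl ne
queried-masked (suc m) (query i k) x z (eq ∷ eqs) ne
  rewrite mask-agree star x z i eq | mask-agree dagger x z i eq = s≤s (queried-masked m _ x z eqs ne)

-- A leaf would answer alike on both masked inputs, so a separating tree must query. This forces `r`
-- to be at least 1 when `f` is not constant.
1≤cost-masked : ∀ {n} (T : DTree Σ₄ n) x z →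
  eval T (mask star x z) ≢ eval T (mask dagger x z) → 1 ℕ.≤ cost T (mask star x z)
1≤cost-masked (leaf _)    x z ne = contradiction refl ne
1≤cost-masked (query _ _) x z ne = s≤s z≤n

-- Hamming distance and single-bit flips

flip : ∀ {n} → Vec Bool n → Fin n → Vec Bool n
flip z i = z [ i ]%= not

hamming : ∀ {n} → Vec Bool n → Vec Bool n → ℕ
hamming []      []      = 0
hamming (a ∷ x) (b ∷ z) = (if does (a Bool.≟ b) then 0 else 1) ℕ.+ hamming x z

hamming-flip : ∀ {n} (x z : Vec Bool n) i → lookup z i ≢ lookup x i →
  hamming x z ≡ suc (hamming x (flip z i))
hamming-flip (true  ∷ x) (true  ∷ z) zero    ne = contradiction refl ne
hamming-flip (true  ∷ x) (false ∷ z) zero    ne = refl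
hamming-flip (false ∷ x) (true  ∷ z) zero    ne = refl
hamming-flip (false ∷ x) (false ∷ z) zero    ne = contradiction refl ne
hamming-flip (a ∷ x)     (b ∷ z)     (suc i) ne =
  trans (cong ((if does (a Bool.≟ b) then 0 else 1) ℕ.+_) (hamming-flip x z i ne)) (ℕ.+-suc _ _)

hamming-zero : ∀ {n} (x z : Vec Bool n) → hamming x z ℕ.≤ 0 → x ≡ z
hamming-zero []      []      _ = refl
hamming-zero (a ∷ x) (b ∷ z) h with a Bool.≟ b
... | yes refl = cong (a ∷_) (hamming-zero x z h)
... | no _ with () ← h

hamming-sym : ∀ {n} (x z : Vec Bool n) → hamming x z ≡ hamming z x
hamming-sym []          []          = refl
hamming-sym (true  ∷ x) (true  ∷ z) = hamming-sym x z
hamming-sym (true  ∷ x) (false ∷ z) = cong suc (hamming-sym x z)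
hamming-sym (false ∷ x) (true  ∷ z) = cong suc (hamming-sym x z)
hamming-sym (false ∷ x) (false ∷ z) = hamming-sym x z

-- On `Q` both `z` and `z*` copy `x`, so a position where they differ lies outside `Q`, and flipping
-- it disturbs nothing in `Q`.
Agree-flip : ∀ {n} (x z z* : Vec Bool n) i Q → lookup z i ≢ lookup z* i →
  Agree x z Q → Agree x z* Q → Agree x (flip z i) Q
Agree-flip x z z* i []      ne []       []       = []
Agree-flip x z z* i (j ∷ Q) ne (p ∷ ps) (q ∷ qs) =
  trans (lookup∘updateAt′ j i (λ { refl → ne (trans p (sym q)) }) z) p ∷ Agree-flip x z z* i Q ne ps qs

sumFin : ∀ {n} → (Fin n → ℚ) → ℚ
sumFin {zero}  h = 0ℚ
sumFin {suc n} h = h zero + sumFin (h ∘ suc)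

expect-sumFin : ∀ {n} (μ : Measure A) (h : A → Fin n → ℚ) →
  expect μ (λ a → sumFin (h a)) ≡ sumFin (λ i → expect μ (λ a → h a i))
expect-sumFin {n = zero}  μ h = expect-zero μ
expect-sumFin {n = suc n} μ h =
  trans (expect-+ μ (λ a → h a zero) (λ a → sumFin (h a ∘ suc)))
        (cong (_+_ (expect μ (λ a → h a zero))) (expect-sumFin μ (λ a → h a ∘ suc)))

sumFin-zero : ∀ n → sumFin {n} (const 0ℚ) ≡ 0ℚ
sumFin-zero zero    = refl
sumFin-zero (suc n) = trans (+-identityˡ _) (sumFin-zero n)

sumFin-ind : ∀ {n} (j : Fin n) → sumFin (λ i → ind (i Fin.≟ j)) ≡ 1ℚ
sumFin-ind {suc n} zero    = trans (cong (_+_ 1ℚ) (sumFin-zero n)) (+-identityʳ 1ℚ)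
sumFin-ind         (suc j) = trans (+-identityˡ _) (sumFin-ind j)

hamming≤sumFin : ∀ {n} (x z : Vec Bool n) h → (∀ i → 0ℚ ≤ h i) →
  (∀ i → lookup z i ≢ lookup x i → 1ℚ ≤ h i) → ℕtoℚ (hamming x z) ≤ sumFin h
hamming≤sumFin []      []      h 0≤h 1≤h = ≤-refl
hamming≤sumFin (a ∷ x) (b ∷ z) h 0≤h 1≤h with hamming≤sumFin x z (h ∘ suc) (0≤h ∘ suc) (1≤h ∘ suc) | a Bool.≟ b
... | ih | yes _  = ≤-trans ih (p≤q+p (0≤h zero))
... | ih | no a≢b = ≤-trans (≤-reflexive (ℕtoℚ-+ 1 (hamming x z))) (+-mono-≤ (1≤h zero (a≢b ∘ sym)) ih)

-- Evasive runs

module Sabotage {n} (f : Vec Bool n → Bool) {S : RandAlg Σ₄ n} {r : ℚ}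
                (sab : ZeroErrorAlgWithin (sabSpec f) S r) where

  S-nonNeg : NonNeg S
  S-nonNeg = proj₁ (proj₁ sab)

  expect-one : expect S (const 1ℚ) ≡ 1ℚ
  expect-one = trans (sym (totalWeight-expect S)) (proj₂ (proj₁ sab))

  expect-const-S : ∀ c → expect S (const c) ≡ c
  expect-const-S c = trans (expect-const S c) (trans (cong (c *_) expect-one) (*-identityʳ c))

  module _ {x z} (fx≢fz : f x ≢ f z) where

    separates : All (λ p → eval (proj₂ p) (mask star x z) ≢ eval (proj₂ p) (mask dagger x z)) S
    separates = All.map (λ {p} correct eq → contradiction
      (trans (sym (correct (mask star x z) false (inj₁ (refl , mask-SabSet f star fx≢fz))))
        (trans eq (correct (mask dagger x z) true (inj₂ (refl , mask-SabSet f dagger fx≢fz)))))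
      λ ()) (proj₁ (proj₂ sab))

    masked-cost : expect S (λ T → ℕtoℚ (cost T (mask star x z))) ≤ r
    masked-cost = ≤-trans (≤-reflexive (sym (expCost-expect S (mask star x z))))
      (proj₂ (proj₂ sab) (mask star x z) false (inj₁ (refl , mask-SabSet f star fx≢fz)))

    1≤r : 1ℚ ≤ r
    1≤r = begin
      1ℚ                                              ≡⟨ expect-one ⟨
      expect S (const 1ℚ)                             ≤⟨ expect-monoᴬ S-nonNeg (All.map (λ {p} ne → ℕtoℚ-mono {1} {cost (proj₂ p) (mask star x z)} (1≤cost-masked (proj₂ p) x z ne)) separates) ⟩
      expect S (λ T → ℕtoℚ (cost T (mask star x z)))  ≤⟨ masked-cost ⟩
      r                                               ∎
      where open ≤-Reasoning

    module _ (c : ℕ) {{_ : ℕ.NonZero c}} (r≤c : r ≤ ℕtoℚ c) where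

      -- Markov's inequality: a tree that evades the difference pays at least `c + c` on the starred
      -- input, where the expected cost is at most `r` and hence at most `c`.
      evasion≤½ : expect S (λ T → ind (agree? x z (queried (c ℕ.+ c) T x))) ≤ ½
      evasion≤½ = *-cancelˡ-≤-pos (ℕtoℚ (c ℕ.+ c)) {{normalize-pos (c ℕ.+ c) 1 {{_}} {{c+c≢0}}}} (begin
        ℕtoℚ (c ℕ.+ c) * expect S evades               ≡⟨ expect-* S (ℕtoℚ (c ℕ.+ c)) evades ⟨
        expect S (λ T → ℕtoℚ (c ℕ.+ c) * evades T)     ≤⟨ expect-monoᴬ S-nonNeg (All.map (λ {p} → pointwise (proj₂ p)) separates) ⟩
        expect S (λ T → ℕtoℚ (cost T (mask star x z))) ≤⟨ masked-cost ⟩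
        r                                              ≤⟨ r≤c ⟩
        ℕtoℚ c                                         ≡⟨ *-identityʳ (ℕtoℚ c) ⟨
        ℕtoℚ c * (½ + ½)                               ≡⟨ lemma (ℕtoℚ c) ½ ⟩
        (ℕtoℚ c + ℕtoℚ c) * ½                          ≡⟨ cong (_* ½) (ℕtoℚ-+ c c) ⟨
        ℕtoℚ (c ℕ.+ c) * ½                             ∎)
        where
        open ≤-Reasoning

        c+c≢0 : ℕ.NonZero (c ℕ.+ c)
        c+c≢0 = ℕ.>-nonZero (ℕ.<-≤-trans (ℕ.>-nonZero⁻¹ c) (ℕ.m≤m+n c c))

        evades : DTree Σ₄ n → ℚ
        evades T = ind (agree? x z (queried (c ℕ.+ c) T x))

        lemma : ∀ c h → c * (h + h) ≡ (c + c) * h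
        lemma = solve-∀ ℚ-ring

        pointwise : ∀ T → eval T (mask star x z) ≢ eval T (mask dagger x z) →
          ℕtoℚ (c ℕ.+ c) * evades T ≤ ℕtoℚ (cost T (mask star x z))
        pointwise T ne with agree? x z (queried (c ℕ.+ c) T x)
        ... | yes ag = ≤-trans (≤-reflexive (*-identityʳ (ℕtoℚ (c ℕ.+ c)))) (ℕtoℚ-mono (queried-masked (c ℕ.+ c) T x z ag ne))
        ... | no  _  = ≤-trans (≤-reflexive (*-zeroʳ (ℕtoℚ (c ℕ.+ c)))) (0≤ℕtoℚ (cost T (mask star x z)))

-- Probes, walks and the potential of a set of queried positions

module Potential {n} (f : Vec Bool n → Bool) {S : RandAlg Σ₄ n} {r : ℚ}
                 (sab : ZeroErrorAlgWithin (sabSpec f) S r)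
                 (c : ℕ) {{_ : ℕ.NonZero c}} (r≤c : r ≤ ℕtoℚ c) where

  open Sabotage f sab

  budget : ℕ
  budget = c ℕ.+ c

  -- Bounds the total mass of `probes`. The same number then bounds the size of a minimal sensitive
  -- block, the length of a walk and its branching at each step.
  reach : ℕ
  reach = 2 ℕ.* budget

  -- The weight 2 makes up for the probability ½ of missing a given violation.
  probes : Vec Bool n → Measure (Fin n)
  probes z = S >>= λ T → weigh (ℕtoℚ 2) (queried budget T z)

  probes-nonNeg : ∀ z → NonNeg (probes z)
  probes-nonNeg z = >>=-nonNeg S-nonNeg λ T → weigh-nonNeg (0≤ℕtoℚ 2) (queried budget T z)

  probes-total : ∀ z → expect (probes z) (const 1ℚ) ≤ ℕtoℚ reach
  probes-total z = begin
    expect (probes z) (const 1ℚ)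
      ≡⟨ expect->>= S _ (const 1ℚ) ⟩
    expect S (λ T → expect (weigh (ℕtoℚ 2) (queried budget T z)) (const 1ℚ))
      ≤⟨ expect-mono S-nonNeg pointwise ⟩
    expect S (const (ℕtoℚ reach))
      ≡⟨ expect-const-S (ℕtoℚ reach) ⟩
    ℕtoℚ reach ∎
    where
    open ≤-Reasoning
    pointwise : ∀ T → expect (weigh (ℕtoℚ 2) (queried budget T z)) (const 1ℚ) ≤ ℕtoℚ reach
    pointwise T = ≤-trans (≤-reflexive (trans (expect-weigh (ℕtoℚ 2) (queried budget T z))
                                              (sym (ℕtoℚ-* 2 (length (queried budget T z))))))
                          (ℕtoℚ-mono (ℕ.*-monoʳ-≤ 2 (length-queried budget T z)))

  weigh-disagree : ∀ {z z*} {h : Fin n → ℚ} → (∀ i → 0ℚ ≤ h i) → (∀ i → lookup z* i ≢ lookup z i → 1ℚ ≤ h i) →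
    ∀ {w} → 0ℚ ≤ w → ∀ Q → ¬ Agree z z* Q → w ≤ expect (weigh w Q) h
  weigh-disagree                 0≤h 1≤h     0≤w []      dis = contradiction [] dis
  weigh-disagree {z} {z*} {h} 0≤h 1≤h {w} 0≤w (j ∷ Q) dis with lookup z* j Bool.≟ lookup z j
  ... | yes eq = ≤-trans (weigh-disagree {z} {z*} 0≤h 1≤h 0≤w Q (dis ∘ (eq ∷_))) (p≤q+p (0≤* 0≤w (0≤h j)))
  ... | no neq = ≤-trans (≤-trans (≤-reflexive (sym (*-identityʳ w))) (*-monoˡ 0≤w (1≤h j neq)))
                         (p≤p+q (expect-nonNeg (weigh-nonNeg 0≤w Q) 0≤h))

  -- A truncated run on `z` touches the difference to `z*` with probability at least one half, and
  -- the weight 2 of each probe lifts this to 1. Leaving `h` arbitrary lets it be the indicator of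
  -- one position as well as the mass found by the rest of a walk.
  hit : ∀ {z z*} {h : Fin n → ℚ} → f z ≢ f z* → (∀ i → 0ℚ ≤ h i) → (∀ i → lookup z* i ≢ lookup z i → 1ℚ ≤ h i) →
    1ℚ ≤ expect (probes z) h
  hit {z} {z*} {h} fz≢fz* 0≤h 1≤h = begin
    1ℚ                                           ≤⟨ +-monoˡ-≤ (- 1ℚ) twice ⟩
    expect (probes z) h + 1ℚ - 1ℚ                ≡⟨ +-assoc (expect (probes z) h) 1ℚ (- 1ℚ) ⟩
    expect (probes z) h + 0ℚ                     ≡⟨ +-identityʳ _ ⟩
    expect (probes z) h                          ∎
    where
    open ≤-Reasoning

    weighed evades : DTree Σ₄ n → ℚ
    weighed T = expect (weigh (ℕtoℚ 2) (queried budget T z)) h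
    evades T = ind (agree? z z* (queried budget T z))

    -- Either the run touches a disagreement and the first summand is at least 2, or it evades and
    -- the second summand is 2.
    pointwise : ∀ T → ℕtoℚ 2 ≤ weighed T + ℕtoℚ 2 * evades T
    pointwise T with agree? z z* (queried budget T z)
    ... | yes _  = p≤q+p (expect-nonNeg (weigh-nonNeg (0≤ℕtoℚ 2) (queried budget T z)) 0≤h)
    ... | no dis = ≤-trans (weigh-disagree {z} {z*} 0≤h 1≤h (0≤ℕtoℚ 2) (queried budget T z) dis) (≤-reflexive (sym (+-identityʳ _)))

    twice : ℕtoℚ 2 ≤ expect (probes z) h + 1ℚ
    twice = begin
      ℕtoℚ 2                                                ≡⟨ expect-const-S (ℕtoℚ 2) ⟨
      expect S (const (ℕtoℚ 2))                             ≤⟨ expect-mono S-nonNeg pointwise ⟩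
      expect S (λ T → weighed T + ℕtoℚ 2 * evades T)        ≡⟨ expect-+ S weighed (λ T → ℕtoℚ 2 * evades T) ⟩
      expect S weighed + expect S (λ T → ℕtoℚ 2 * evades T) ≡⟨ cong₂ _+_ (sym (expect->>= S _ h)) (expect-* S (ℕtoℚ 2) evades) ⟩
      expect (probes z) h + ℕtoℚ 2 * expect S evades        ≤⟨ +-monoʳ-≤ (expect (probes z) h) (*-monoˡ (0≤ℕtoℚ 2) (evasion≤½ fz≢fz* c r≤c)) ⟩
      expect (probes z) h + ℕtoℚ 2 * ½                      ≡⟨⟩
      expect (probes z) h + 1ℚ                              ∎

  -- `z` and `flip z i` differ only at `i`, so `hit` gives every sensitive position a probe mass of
  -- at least 1, while the total mass is at most `reach`.
  hamming≤reach : ∀ x z → (∀ i → lookup z i ≢ lookup x i → f z ≢ f (flip z i)) → hamming x z ℕ.≤ reach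
  hamming≤reach x z sensitive = ℕtoℚ-cancel-≤ (begin
    ℕtoℚ (hamming x z)                                          ≤⟨ hamming≤sumFin x z h 0≤h 1≤h ⟩
    sumFin h                                                    ≡⟨ expect-sumFin (probes z) (λ j i → ind (i Fin.≟ j)) ⟨
    expect (probes z) (λ j → sumFin (λ i → ind (i Fin.≟ j)))    ≡⟨ expect-cong (probes z) sumFin-ind ⟩
    expect (probes z) (const 1ℚ)                                ≤⟨ probes-total z ⟩
    ℕtoℚ reach                                                  ∎)
    where
    open ≤-Reasoning

    h : Fin n → ℚ
    h i = expect (probes z) (λ j → ind (i Fin.≟ j))

    0≤h : ∀ i → 0ℚ ≤ h i
    0≤h i = expect-nonNeg (probes-nonNeg z) (λ j → 0≤ind (i Fin.≟ j))

    1≤h : ∀ i → lookup z i ≢ lookup x i → 1ℚ ≤ h i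
    1≤h i ne = hit {z} {flip z i} (sensitive i ne) (λ j → 0≤ind (i Fin.≟ j)) λ j ne′ → ≤-reflexive (sym (ind-yes (i Fin.≟ j) (flipped j ne′)))
      where
      flipped : ∀ j → lookup (flip z i) j ≢ lookup z j → i ≡ j
      flipped j ne′ with i Fin.≟ j
      ... | yes eq = eq
      ... | no neq = contradiction (lookup∘updateAt′ j i (neq ∘ sym) z) ne′

  -- A violation as close to x as possible is sensitive at every position where it differs from x.
  near-violation : ∀ x Q k {z} → hamming x z ℕ.≤ k → Agree x z Q → f z ≢ f x →
    ∃ λ z* → Agree x z* Q × f z* ≢ f x × hamming x z* ℕ.≤ reach
  near-violation x Q k {z} h≤k ag fz≢fx
    -- Look for a difference from `x` that can be undone while the value stays different from `f x`.
    -- If there is none, every difference is sensitive; otherwise undoing it lowers the distance,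
    -- for which `k` serves as fuel.
    with Fin.any? (λ i → ¬? (lookup z i Bool.≟ lookup x i) ×-dec ¬? (f (flip z i) Bool.≟ f x))
  ... | no none = z , ag , fz≢fx , hamming≤reach x z λ i ne fz≡ →
          none (i , ne , λ fl → fz≢fx (trans fz≡ fl))
  near-violation x Q zero    {z} h≤k ag fz≢fx | yes (i , ne , fl) =
    contradiction (ℕ.≤-trans (ℕ.≤-reflexive (sym (hamming-flip x z i ne))) h≤k) λ ()
  near-violation x Q (suc k) {z} h≤k ag fz≢fx | yes (i , ne , fl) =
    near-violation x Q k (ℕ.s≤s⁻¹ (ℕ.≤-trans (ℕ.≤-reflexive (sym (hamming-flip x z i ne))) h≤k))
      (Agree-flip x z x i Q ne ag (All.universal (λ _ → refl) Q)) fl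

  -- The mass of the walk's violating ends stands in for the number of minimal sensitive blocks.
  walk : Bool → ℕ → Vec Bool n → Measure (Vec Bool n)
  walk b zero    z = dirac z
  walk b (suc d) z = if does (f z Bool.≟ b) then (probes z >>= λ i → walk b d (flip z i)) else dirac z

  walk-nonNeg : ∀ b d z → NonNeg (walk b d z)
  walk-nonNeg b zero    z = 0≤1 ∷ []
  walk-nonNeg b (suc d) z with f z Bool.≟ b
  ... | yes _ = >>=-nonNeg (probes-nonNeg z) (λ i → walk-nonNeg b d (flip z i))
  ... | no  _ = 0≤1 ∷ []

  1≤reach^ : ∀ d → 1ℚ ≤ ℕtoℚ (reach ℕ.^ d)
  1≤reach^ d = ℕtoℚ-mono {1} (ℕ.m^n>0 reach {{reach≢0}} d)
    where
    reach≢0 : ℕ.NonZero reach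
    reach≢0 = ℕ.>-nonZero (ℕ.<-≤-trans (ℕ.>-nonZero⁻¹ c) (ℕ.≤-trans (ℕ.m≤m+n c c) (ℕ.m≤m+n budget (budget ℕ.+ 0))))

  -- Each step multiplies the mass by at most `reach`; a walk that stops early has mass 1, which is
  -- at most any power of `reach`.
  walk-total : ∀ b d z → expect (walk b d z) (const 1ℚ) ≤ ℕtoℚ (reach ℕ.^ d)
  walk-total b zero    z = ≤-reflexive (expect-dirac z (const 1ℚ))
  walk-total b (suc d) z with f z Bool.≟ b
  ... | no  _ = ≤-trans (≤-reflexive (expect-dirac z (const 1ℚ))) (1≤reach^ (suc d))
  ... | yes _ = begin
    expect (probes z >>= λ i → walk b d (flip z i)) (const 1ℚ)         ≡⟨ expect->>= (probes z) _ (const 1ℚ) ⟩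
    expect (probes z) (λ i → expect (walk b d (flip z i)) (const 1ℚ))  ≤⟨ expect-mono (probes-nonNeg z) (λ i → walk-total b d (flip z i)) ⟩
    expect (probes z) (const (ℕtoℚ (reach ℕ.^ d)))                     ≡⟨ expect-const (probes z) _ ⟩
    ℕtoℚ (reach ℕ.^ d) * expect (probes z) (const 1ℚ)                  ≤⟨ *-monoˡ (0≤ℕtoℚ (reach ℕ.^ d)) (probes-total z) ⟩
    ℕtoℚ (reach ℕ.^ d) * ℕtoℚ reach                                    ≡⟨ *-comm _ (ℕtoℚ reach) ⟩
    ℕtoℚ reach * ℕtoℚ (reach ℕ.^ d)                                    ≡⟨ ℕtoℚ-* reach (reach ℕ.^ d) ⟨
    ℕtoℚ (reach ℕ.^ suc d)                                             ∎
    where open ≤-Reasoning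

  violates : Vec Bool n → List (Fin n) → Vec Bool n → ℚ
  violates x Q z = ind (agree? x z Q ×-dec ¬? (f z Bool.≟ f x))

  -- The walk starts at `x` and does not depend on `Q`, which only selects the ends to be counted.
  -- Further answers can therefore only remove mass.
  potential : Vec Bool n → List (Fin n) → ℚ
  potential x Q = expect (walk (f x) reach x) (violates x Q)

  0≤potential : ∀ x Q → 0ℚ ≤ potential x Q
  0≤potential x Q = expect-nonNeg (walk-nonNeg (f x) reach x) (λ z → 0≤ind (agree? x z Q ×-dec ¬? (f z Bool.≟ f x)))

  potential≤reach^reach : ∀ x Q → potential x Q ≤ ℕtoℚ (reach ℕ.^ reach)
  potential≤reach^reach x Q = ≤-trans
    (expect-mono (walk-nonNeg (f x) reach x) (λ z → ind≤1 (agree? x z Q ×-dec ¬? (f z Bool.≟ f x))))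
    (walk-total (f x) reach x)

  1≤violates : ∀ {x z Q} → Agree x z Q → f z ≢ f x → 1ℚ ≤ expect (dirac z) (violates x Q)
  1≤violates {x} {z} {Q} ag fz≢fx = ≤-reflexive (sym (trans (expect-dirac z (violates x Q))
    (ind-yes (agree? x z Q ×-dec ¬? (f z Bool.≟ f x)) (ag , fz≢fx))))

  -- While `z` is no violation, its value differs from that of `z*`, so `hit` puts mass at least 1
  -- on flips that bring `z` nearer to `z*`. These preserve agreement on `Q`, and any violation met
  -- on the way counts as well as `z*` does.
  walk-finds : ∀ {x Q z*} → Agree x z* Q → f z* ≢ f x →
    ∀ d z → Agree x z Q → hamming z* z ℕ.≤ d → 1ℚ ≤ expect (walk (f x) d z) (violates x Q)
  walk-finds {x} {Q} {z*} ag* fz*≢fx zero    z ag h≤d with refl ← hamming-zero z* z h≤d = 1≤violates {x} {z*} {Q} ag* fz*≢fx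
  walk-finds {x} {Q} {z*} ag* fz*≢fx (suc d) z ag h≤d with f z Bool.≟ f x
  ... | no fz≢fx  = 1≤violates {x} {z} {Q} ag fz≢fx
  ... | yes fz≡fx = ≤-trans
    (hit {z} {z*} (λ fz≡fz* → fz*≢fx (trans (sym fz≡fz*) fz≡fx))
      (λ i → expect-nonNeg (walk-nonNeg (f x) d (flip z i)) (λ y → 0≤ind (agree? x y Q ×-dec ¬? (f y Bool.≟ f x))))
      (λ i ne → walk-finds ag* fz*≢fx d (flip z i) (Agree-flip x z z* i Q (ne ∘ sym) ag ag*)
        (ℕ.s≤s⁻¹ (ℕ.≤-trans (ℕ.≤-reflexive (sym (hamming-flip z* z i (ne ∘ sym)))) h≤d))))
    (≤-reflexive (sym (expect->>= (probes z) _ (violates x Q))))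

  -- `near-violation` replaces `z` by a violation within distance `reach` of `x`, so a walk of
  -- `reach` steps is long enough.
  1≤potential : ∀ {x z Q} → Agree x z Q → f z ≢ f x → 1ℚ ≤ potential x Q
  1≤potential {x} {z} {Q} ag fz≢fx with near-violation x Q (hamming x z) ℕ.≤-refl ag fz≢fx
  ... | z* , ag* , fz*≢fx , h≤reach =
    walk-finds ag* fz*≢fx reach x (All.universal (λ _ → refl) Q)
      (ℕ.≤-trans (ℕ.≤-reflexive (hamming-sym z* x)) h≤reach)

  -- The walk is independent of the new run, so the expectations can be exchanged and each violating
  -- end treated alone: it survives only if the run misses its difference from `x`, which has
  -- probability at most one half.
  potential-halves : ∀ x Q → expect S (λ T → potential x (Q ++ queried budget T x)) ≤ ½ * potential x Q
  potential-halves x Q = begin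
    expect S (λ T → expect μ (violates x (Q ++ queried budget T x)))  ≡⟨ expect-swap S μ (λ T → violates x (Q ++ queried budget T x)) ⟩
    expect μ (λ z → expect S (λ T → violates x (Q ++ queried budget T x) z))
                                                                      ≤⟨ expect-mono (walk-nonNeg (f x) reach x) pointwise ⟩
    expect μ (λ z → ½ * violates x Q z)                               ≡⟨ expect-* μ ½ (violates x Q) ⟩
    ½ * potential x Q                                                 ∎
    where
    open ≤-Reasoning

    μ : Measure (Vec Bool n)
    μ = walk (f x) reach x

    pointwise : ∀ z → expect S (λ T → violates x (Q ++ queried budget T x) z) ≤ ½ * violates x Q z
    pointwise z with agree? x z Q ×-dec ¬? (f z Bool.≟ f x)
    ... | no fine = ≤-reflexive (trans (trans (expect-cong S λ T →
            ind-no (agree? x z (Q ++ queried budget T x) ×-dec ¬? (f z Bool.≟ f x))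
              (λ (ag , fz≢fx) → fine (All.++⁻ˡ Q ag , fz≢fx)))
            (expect-zero S))
            (sym (trans (cong (½ *_) (ind-no (agree? x z Q ×-dec ¬? (f z Bool.≟ f x)) fine)) (*-zeroʳ ½))))
    ... | yes p@(_ , fz≢fx) = ≤-trans (≤-trans (expect-mono S-nonNeg λ T →
            ind-mono (agree? x z (Q ++ queried budget T x) ×-dec ¬? (f z Bool.≟ f x)) (agree? x z (queried budget T x))
              (λ (ag , _) → All.++⁻ʳ Q ag))
            (evasion≤½ (fz≢fx ∘ sym) c r≤c))
            (≤-reflexive (sym (trans (cong (½ *_) (ind-yes (agree? x z Q ×-dec ¬? (f z Bool.≟ f x)) p)) (*-identityʳ ½))))

-- Zero-error algorithm

Knowledge : ℕ → Set
Knowledge n = List (Fin n × Bool)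

know : ∀ {n} → Vec Bool n → List (Fin n) → Knowledge n
know x = map (λ i → i , lookup x i)

Fits : ∀ {n} → Knowledge n → Vec Bool n → Set
Fits ρ z = All (λ (i , b) → lookup z i ≡ b) ρ

fits? : ∀ {n} (ρ : Knowledge n) z → Dec (Fits ρ z)
fits? ρ z = All.all? (λ (i , b) → lookup z i Bool.≟ b) ρ

anyVec? : ∀ {n} {R : Vec Bool n → Set} → (∀ z → Dec (R z)) → Dec (∃ R)
anyVec? {zero}  R? = map′ ([] ,_) (λ { ([] , p) → p }) (R? [])
anyVec? {suc n} R? = map′
  (λ { (inj₁ (z , p)) → true ∷ z , p ; (inj₂ (z , p)) → false ∷ z , p })
  (λ { (true ∷ z , p) → inj₁ (z , p) ; (false ∷ z , p) → inj₂ (z , p) })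
  (anyVec? (R? ∘ (true ∷_)) ⊎-dec anyVec? (R? ∘ (false ∷_)))

-- Passing the gathered answers to a continuation keeps successive truncated runs inside a single
-- Boolean decision tree.
simulate : ∀ {n} → ℕ → DTree Σ₄ n → (Knowledge n → DTree Bool n) → DTree Bool n
simulate zero    _           k = k []
simulate (suc m) (leaf _)    k = k []
simulate (suc m) (query i T) k = query i λ b → simulate m (T (fromBool b)) (λ σ → k ((i , b) ∷ σ))

eval-simulate : ∀ {n} m (T : DTree Σ₄ n) k x → eval (simulate m T k) x ≡ eval (k (know x (queried m T x))) x
eval-simulate zero    _           k x = refl
eval-simulate (suc m) (leaf _)    k x = refl
eval-simulate (suc m) (query i T) k x = eval-simulate m (T (fromBool (lookup x i))) (λ σ → k ((i , lookup x i) ∷ σ)) x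

cost-simulate : ∀ {n} m (T : DTree Σ₄ n) k x → cost (simulate m T k) x ℕ.≤ m ℕ.+ cost (k (know x (queried m T x))) x
cost-simulate zero    _           k x = ℕ.≤-refl
cost-simulate (suc m) (leaf _)    k x = ℕ.m≤n+m _ (suc m)
cost-simulate (suc m) (query i T) k x = s≤s (cost-simulate m (T (fromBool (lookup x i))) (λ σ → k ((i , lookup x i) ∷ σ)) x)

weaken : ∀ {n} → DTree A n → DTree A (suc n)
weaken (leaf b)    = leaf b
weaken (query i T) = query (suc i) (λ a → weaken (T a))

eval-weaken : ∀ {n} (T : DTree A n) a x → eval (weaken T) (a ∷ x) ≡ eval T x
eval-weaken (leaf b)    a x = refl
eval-weaken (query i T) a x = eval-weaken (T (lookup x i)) a x

cost-weaken : ∀ {n} (T : DTree A n) a x → cost (weaken T) (a ∷ x) ≡ cost T x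
cost-weaken (leaf b)    a x = refl
cost-weaken (query i T) a x = cong suc (cost-weaken (T (lookup x i)) a x)

-- The fallback once every sampled tree has been used; it guarantees a correct answer at cost `n`.
readAll : ∀ {n} → (Vec A n → Bool) → DTree A n
readAll {n = zero}  f = leaf (f [])
readAll {n = suc n} f = query zero (λ a → weaken (readAll (f ∘ (a ∷_))))

eval-readAll : ∀ {n} (f : Vec A n → Bool) x → eval (readAll f) x ≡ f x
eval-readAll f []      = refl
eval-readAll f (a ∷ x) = trans (eval-weaken (readAll (f ∘ (a ∷_))) a x) (eval-readAll (f ∘ (a ∷_)) x)

cost-readAll : ∀ {n} (f : Vec A n → Bool) x → cost (readAll f) x ≡ n
cost-readAll f []      = refl
cost-readAll f (a ∷ x) = cong suc (trans (cost-weaken (readAll (f ∘ (a ∷_))) a x) (cost-readAll (f ∘ (a ∷_)) x))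

-- Independent samples and powers of one half

words : Measure A → ℕ → Measure (List A)
words μ zero    = dirac []
words μ (suc K) = μ >>= λ a → map (map₂ (a ∷_)) (words μ K)

expect-words : ∀ (μ : Measure A) K g →
  expect (words μ (suc K)) g ≡ expect μ (λ a → expect (words μ K) (λ as → g (a ∷ as)))
expect-words μ K g = trans (expect->>= μ _ g) (expect-cong μ λ a → expect-map (a ∷_) (words μ K) g)

words-nonNeg : ∀ {μ : Measure A} → NonNeg μ → ∀ K → NonNeg (words μ K)
words-nonNeg 0≤μ zero    = 0≤1 ∷ []
words-nonNeg 0≤μ (suc K) = >>=-nonNeg 0≤μ (λ a → All.map⁺ (words-nonNeg 0≤μ K))

words-total : ∀ (μ : Measure A) → expect μ (const 1ℚ) ≡ 1ℚ → ∀ K → expect (words μ K) (const 1ℚ) ≡ 1ℚ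
words-total {A} μ one zero = expect-dirac {List A} [] (const 1ℚ)
words-total μ one (suc K) = trans (expect-words μ K (const 1ℚ)) (trans (expect-cong μ λ _ → words-total μ one K) one)

-- Behind the choice of `n` extra rounds: halving `n` times brings the fallback cost `n` down to at
-- most 1.
n<2^n : ∀ n → n ℕ.< 2 ℕ.^ n
n<2^n zero    = s≤s z≤n
n<2^n (suc n) = ℕ.+-mono-≤ (ℕ.m^n>0 2 n) (ℕ.≤-trans (n<2^n n) (ℕ.m≤m+n (2 ℕ.^ n) 0))

decay : ℕ → ℚ
decay zero    = 1ℚ
decay (suc t) = ½ * decay t

0≤decay : ∀ t → 0ℚ ≤ decay t
0≤decay zero    = 0≤1
0≤decay (suc t) = 0≤* 0≤½ (0≤decay t)

decay-2^ : ∀ t → decay t * ℕtoℚ (2 ℕ.^ t) ≡ 1ℚ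
decay-2^ zero    = refl
decay-2^ (suc t) = begin
  ½ * decay t * ℕtoℚ (2 ℕ.* 2 ℕ.^ t)          ≡⟨ cong (½ * decay t *_) (ℕtoℚ-* 2 (2 ℕ.^ t)) ⟩
  ½ * decay t * (ℕtoℚ 2 * ℕtoℚ (2 ℕ.^ t))     ≡⟨ lemma ½ (decay t) (ℕtoℚ 2) (ℕtoℚ (2 ℕ.^ t)) ⟩
  ½ * ℕtoℚ 2 * (decay t * ℕtoℚ (2 ℕ.^ t))     ≡⟨ cong (½ * ℕtoℚ 2 *_) (decay-2^ t) ⟩
  1ℚ                                          ∎
  where
  open ≡-Reasoning
  lemma : ∀ a b c d → a * b * (c * d) ≡ a * c * (b * d)
  lemma = solve-∀ ℚ-ring

decay-≤2^ : ∀ {p} t → p ≤ ℕtoℚ (2 ℕ.^ t) → decay t * p ≤ 1ℚ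
decay-≤2^ t p≤ = ≤-trans (*-monoˡ (0≤decay t) p≤) (≤-reflexive (decay-2^ t))

-- Correctness and expected cost of the repeated runs

module Algorithm {n} (f : Vec Bool n → Bool) {S : RandAlg Σ₄ n} {r : ℚ}
                 (sab : ZeroErrorAlgWithin (sabSpec f) S r)
                 (c : ℕ) {{_ : ℕ.NonZero c}} (r≤c : r ≤ ℕtoℚ c) where

  open Sabotage f sab
  open Potential f sab c r≤c

  -- Absence of a violation means that `ρ` is a certificate for the value `b`. The search through
  -- all inputs costs no queries.
  violation? : ∀ ρ b → Dec (∃ λ z → Fits ρ z × f z ≢ b)
  violation? ρ b = anyVec? (λ z → fits? ρ z ×-dec ¬? (f z Bool.≟ b))

  stopOr : Knowledge n → DTree Bool n → DTree Bool n
  stopOr ρ t =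
    if does (violation? ρ true)
    then (if does (violation? ρ false) then t else leaf false)
    else leaf true

  eval-stopOr : ∀ ρ t {x} → Fits ρ x → eval t x ≡ f x → eval (stopOr ρ t) x ≡ f x
  eval-stopOr ρ t {x} fits correct with violation? ρ true | violation? ρ false
  ... | no certified | _            = sym (decidable-stable (f x Bool.≟ true) (λ ne → certified (x , fits , ne)))
  ... | yes _        | no certified = sym (decidable-stable (f x Bool.≟ false) (λ ne → certified (x , fits , ne)))
  ... | yes _        | yes _        = correct

  -- Whether the tree stops depends on `ρ` and not on `t`, so one case distinction serves every
  -- continuation.
  cost-stopOr : ∀ ρ x → (∀ t → cost (stopOr ρ t) x ≡ 0) ⊎
    ((∃ λ z → Fits ρ z × f z ≢ f x) × (∀ t → cost (stopOr ρ t) x ≡ cost t x))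
  cost-stopOr ρ x with violation? ρ true | violation? ρ false
  ... | no _   | _      = inj₁ (λ _ → refl)
  ... | yes _  | no _   = inj₁ (λ _ → refl)
  -- With both values still open, the witness taken is the one that contradicts the actual value
  -- `f x`.
  ... | yes v₁ | yes v₀ with f x
  ...   | true  = inj₂ (v₁ , λ _ → refl)
  ...   | false = inj₂ (v₀ , λ _ → refl)

  -- The trees are sampled in advance as a list, so that once they are fixed the procedure is one
  -- deterministic decision tree.
  run : List (DTree Σ₄ n) → Knowledge n → DTree Bool n
  run []       ρ = stopOr ρ (readAll f)
  run (T ∷ Ts) ρ = stopOr ρ (simulate budget T (λ σ → run Ts (ρ ++ σ)))

  eval-run : ∀ Ts ρ x → Fits ρ x → eval (run Ts ρ) x ≡ f x
  eval-run []       ρ x fits = eval-stopOr ρ (readAll f) fits (eval-readAll f x)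
  eval-run (T ∷ Ts) ρ x fits = eval-stopOr ρ _ fits
    (trans (eval-simulate budget T (λ σ → run Ts (ρ ++ σ)) x)
      (eval-run Ts _ x (All.++⁺ fits (All.map⁺ (All.universal (λ _ → refl) (queried budget T x))))))

  charge : Vec Bool n → List (Fin n) → List (DTree Σ₄ n) → ℚ
  charge x Q Ts = ℕtoℚ (cost (run Ts (know x Q)) x)

  runCost : ℕ → Vec Bool n → List (Fin n) → ℚ
  runCost K x Q = expect (words S K) (charge x Q)

  words-S-const : ∀ K p → expect (words S K) (const p) ≡ p
  words-S-const K p = trans (expect-const (words S K) p)
    (trans (cong (p *_) (words-total S expect-one K)) (*-identityʳ p))

  charge-free : ∀ {x Q} → (∀ t → cost (stopOr (know x Q) t) x ≡ 0) → ∀ Ts → charge x Q Ts ≡ 0ℚ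
  charge-free free []       = cong ℕtoℚ (free (readAll f))
  charge-free {x} {Q} free (T ∷ Ts) = cong ℕtoℚ (free (simulate budget T (λ σ → run Ts (know x Q ++ σ))))

  charge-∷ : ∀ {x Q} → (∀ t → cost (stopOr (know x Q) t) x ≡ cost t x) → ∀ T Ts →
    charge x Q (T ∷ Ts) ≤ ℕtoℚ budget + charge x (Q ++ queried budget T x) Ts
  charge-∷ {x} {Q} pays T Ts = ≤-trans (ℕtoℚ-mono {cost (run (T ∷ Ts) (know x Q)) x} {budget ℕ.+ rest} step)
    (≤-reflexive (ℕtoℚ-+ budget rest))
    where
    rest : ℕ
    rest = cost (run Ts (know x (Q ++ queried budget T x))) x

    step : cost (run (T ∷ Ts) (know x Q)) x ℕ.≤ budget ℕ.+ rest
    step = ℕ.≤-trans (ℕ.≤-reflexive (pays (simulate budget T (λ σ → run Ts (know x Q ++ σ)))))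
      (subst (λ ρ → cost (simulate budget T (λ σ → run Ts (know x Q ++ σ))) x ℕ.≤ budget ℕ.+ cost (run Ts ρ) x)
        (sym (map-++ (λ i → i , lookup x i) Q (queried budget T x)))
        (cost-simulate budget T (λ σ → run Ts (know x Q ++ σ)) x))

  runCost-free : ∀ {x Q} → (∀ t → cost (stopOr (know x Q) t) x ≡ 0) → ∀ K → runCost K x Q ≡ 0ℚ
  runCost-free {x} {Q} free K = trans (expect-cong (words S K) (charge-free {x} {Q} free)) (expect-zero (words S K))

  -- Without a certificate the potential is at least 1, so it can pay for the `n` queries of the
  -- fallback.
  runCost-zero : ∀ x Q → runCost zero x Q ≤ ℕtoℚ n * potential x Q
  runCost-zero x Q = case cost-stopOr (know x Q) x of λ where
      (inj₁ free) → ≤-trans (≤-reflexive (runCost-free {x} {Q} free zero)) (0≤* (0≤ℕtoℚ n) (0≤potential x Q))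
      (inj₂ ((z , fits , fz≢fx) , pays)) → begin
        runCost zero x Q          ≡⟨ expect-dirac [] (charge x Q) ⟩
        charge x Q []             ≡⟨ cong ℕtoℚ (all-read pays) ⟩
        ℕtoℚ n                    ≡⟨ *-identityʳ (ℕtoℚ n) ⟨
        ℕtoℚ n * 1ℚ               ≤⟨ *-monoˡ (0≤ℕtoℚ n) (1≤potential {x} {z} {Q} (All.map⁻ fits) fz≢fx) ⟩
        ℕtoℚ n * potential x Q    ∎
    where
    open ≤-Reasoning
    all-read : (∀ t → cost (stopOr (know x Q) t) x ≡ cost t x) → cost (run [] (know x Q)) x ≡ n
    all-read pays = trans (pays (readAll f)) (cost-readAll f x)

  -- Splits off the first round in a form that serves two bounds: one charges the budget to the
  -- potential, the other just counts rounds.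
  runCost-suc : ∀ K x Q → runCost (suc K) x Q ≤ 0ℚ ⊎
    (1ℚ ≤ potential x Q × runCost (suc K) x Q ≤ ℕtoℚ budget + expect S (λ T → runCost K x (Q ++ queried budget T x)))
  runCost-suc K x Q = case cost-stopOr (know x Q) x of λ where
      (inj₁ free) → inj₁ (≤-reflexive (runCost-free {x} {Q} free (suc K)))
      (inj₂ ((z , fits , fz≢fx) , pays)) → inj₂ (1≤potential {x} {z} {Q} (All.map⁻ fits) fz≢fx , (begin
        runCost (suc K) x Q
          ≡⟨ expect-words S K (charge x Q) ⟩
        expect S (λ T → expect (words S K) (λ Ts → charge x Q (T ∷ Ts)))
          ≤⟨ expect-mono S-nonNeg (λ T → expect-mono (words-nonNeg S-nonNeg K) (charge-∷ {x} {Q} pays T)) ⟩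
        expect S (λ T → expect (words S K) (λ Ts → b + charge x (Q ++ queried budget T x) Ts))
          ≡⟨ expect-cong S (λ T → trans (expect-+ (words S K) (const b) (charge x (Q ++ queried budget T x)))
                                        (cong (_+ next T) (words-S-const K b))) ⟩
        expect S (λ T → b + next T)
          ≡⟨ expect-+ S (const b) next ⟩
        expect S (const b) + expect S next
          ≡⟨ cong (_+ expect S next) (expect-const-S b) ⟩
        b + expect S next ∎))
    where
    open ≤-Reasoning
    b : ℚ
    b = ℕtoℚ budget
    next : DTree Σ₄ n → ℚ
    next T = runCost K x (Q ++ queried budget T x)

  -- Solves the recurrence `slope (suc k) = budget + ½ * slope k`: its fixed point is twice the
  -- budget, and the initial excess `n` is halved in each round.
  slope : ℕ → ℚ
  slope k = ℕtoℚ budget + ℕtoℚ budget + decay k * ℕtoℚ n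

  0≤slope : ∀ k → 0ℚ ≤ slope k
  0≤slope k = 0≤+ (0≤+ (0≤ℕtoℚ budget) (0≤ℕtoℚ budget)) (0≤* (0≤decay k) (0≤ℕtoℚ n))

  expect-potential : ∀ {a} x Q → 0ℚ ≤ a →
    expect S (λ T → a * potential x (Q ++ queried budget T x)) ≤ a * (½ * potential x Q)
  expect-potential {a} x Q 0≤a = ≤-trans (≤-reflexive (expect-* S a _)) (*-monoˡ 0≤a (potential-halves x Q))

  -- The cost of a round is charged to the decrease of the potential, which is at least 1 while no certificate is known.
  runCost-slope : ∀ k x Q → runCost k x Q ≤ slope k * potential x Q
  runCost-slope zero x Q = ≤-trans (runCost-zero x Q) (*-monoʳ (0≤potential x Q)
    (≤-trans (≤-reflexive (sym (*-identityˡ (ℕtoℚ n)))) (p≤q+p (0≤+ (0≤ℕtoℚ budget) (0≤ℕtoℚ budget)))))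
  runCost-slope (suc k) x Q = case runCost-suc k x Q of λ where
      (inj₁ le)         → ≤-trans le (0≤* (0≤slope (suc k)) (0≤potential x Q))
      (inj₂ (1≤Φ , le)) → begin
        runCost (suc k) x Q
          ≤⟨ le ⟩
        b + expect S (λ T → runCost k x (Q ++ queried budget T x))
          ≤⟨ +-mono-≤ (≤-trans (≤-reflexive (sym (*-identityʳ b))) (*-monoˡ (0≤ℕtoℚ budget) 1≤Φ))
                      (≤-trans (expect-mono S-nonNeg (λ T → runCost-slope k x (Q ++ queried budget T x)))
                               (expect-potential x Q (0≤slope k))) ⟩
        b * Φ + (b + b + decay k * ℕtoℚ n) * (½ * Φ)
          ≡⟨ lemma b (decay k) (ℕtoℚ n) Φ ½ ⟩
        (b + b * (½ + ½) + decay (suc k) * ℕtoℚ n) * Φ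
          ≡⟨ cong (λ p → (b + p + decay (suc k) * ℕtoℚ n) * Φ) (*-identityʳ b) ⟩
        slope (suc k) * Φ ∎
    where
    open ≤-Reasoning
    b Φ : ℚ
    b = ℕtoℚ budget
    Φ = potential x Q
    lemma : ∀ b d m p h → b * p + (b + b + d * m) * (h * p) ≡ (b + b * (h + h) + h * d * m) * p
    lemma = solve-∀ ℚ-ring

  -- The potential may start near `reach ^ reach`, too large to charge every round to it. The first
  -- `t` rounds are therefore paid at full budget while they halve the expected potential, and only
  -- the later `k` rounds are charged to it.
  runCost-decay : ∀ t k x Q → runCost (t ℕ.+ k) x Q ≤ ℕtoℚ (t ℕ.* budget) + decay t * slope k * potential x Q
  runCost-decay zero k x Q = ≤-trans (runCost-slope k x Q)
    (≤-reflexive (sym (trans (+-identityˡ _) (cong (_* potential x Q) (*-identityˡ (slope k))))))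
  runCost-decay (suc t) k x Q = case runCost-suc (t ℕ.+ k) x Q of λ where
      (inj₁ le)       → ≤-trans le (0≤+ (0≤ℕtoℚ (suc t ℕ.* budget)) (0≤* (0≤* (0≤decay (suc t)) (0≤slope k)) (0≤potential x Q)))
      (inj₂ (_ , le)) → begin
        runCost (suc t ℕ.+ k) x Q
          ≤⟨ le ⟩
        b + expect S (λ T → runCost (t ℕ.+ k) x (Q ++ queried budget T x))
          ≤⟨ +-monoʳ-≤ b (expect-mono S-nonNeg (λ T → runCost-decay t k x (Q ++ queried budget T x))) ⟩
        b + expect S (λ T → tb + d * potential x (Q ++ queried budget T x))
          ≡⟨ cong (_+_ b) (trans (expect-+ S (const tb) _) (cong (_+ expect S (λ T → d * potential x (Q ++ queried budget T x))) (expect-const-S tb))) ⟩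
        b + (tb + expect S (λ T → d * potential x (Q ++ queried budget T x)))
          ≤⟨ +-monoʳ-≤ b (+-monoʳ-≤ tb (expect-potential x Q (0≤* (0≤decay t) (0≤slope k)))) ⟩
        b + (tb + d * (½ * Φ))
          ≡⟨ lemma b tb (decay t) (slope k) ½ Φ ⟩
        (b + tb) + decay (suc t) * slope k * Φ
          ≡⟨ cong (_+ decay (suc t) * slope k * Φ) (ℕtoℚ-+ budget (t ℕ.* budget)) ⟨
        ℕtoℚ (suc t ℕ.* budget) + decay (suc t) * slope k * Φ ∎
    where
    open ≤-Reasoning
    b tb d Φ : ℚ
    b  = ℕtoℚ budget
    tb = ℕtoℚ (t ℕ.* budget)
    d  = decay t * slope k
    Φ  = potential x Q
    lemma : ∀ b e d s h p → b + (e + d * s * (h * p)) ≡ (b + e) + h * d * s * p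
    lemma = solve-∀ ℚ-ring

  -- For suitable `t` the first `t` rounds bring the expected potential down to at most 1; the `n`
  -- further rounds make the fallback cheap.
  algorithm : ℕ → RandAlg Bool n
  algorithm t = map (map₂ (λ Ts → run Ts [])) (words S (t ℕ.+ n))

  algorithm-within : ∀ t → reach ℕ.^ reach ℕ.≤ 2 ℕ.^ t →
    ZeroErrorAlgWithin (totalSpec f) (algorithm t) (ℕtoℚ (t ℕ.* budget ℕ.+ (budget ℕ.+ budget ℕ.+ 1)))
  algorithm-within t reach^reach≤2^t =
    (All.map⁺ (words-nonNeg S-nonNeg (t ℕ.+ n)) , total) ,
    All.map⁺ (All.universal (λ (_ , Ts) x b fx≡b → trans (eval-run Ts [] x []) fx≡b) _) ,
    λ x _ _ → within x
    where
    open ≤-Reasoning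

    total : totalWeight (algorithm t) ≡ 1ℚ
    total = trans (totalWeight-expect (algorithm t))
      (trans (expect-map (λ Ts → run Ts []) (words S (t ℕ.+ n)) (const 1ℚ)) (words-total S expect-one (t ℕ.+ n)))

    slope≤ : slope n ≤ ℕtoℚ (budget ℕ.+ budget ℕ.+ 1)
    slope≤ = begin
      ℕtoℚ budget + ℕtoℚ budget + decay n * ℕtoℚ n   ≤⟨ +-monoʳ-≤ (ℕtoℚ budget + ℕtoℚ budget) (decay-≤2^ n (ℕtoℚ-mono (ℕ.<⇒≤ (n<2^n n)))) ⟩
      ℕtoℚ budget + ℕtoℚ budget + ℕtoℚ 1             ≡⟨ cong (_+ ℕtoℚ 1) (ℕtoℚ-+ budget budget) ⟨
      ℕtoℚ (budget ℕ.+ budget) + ℕtoℚ 1              ≡⟨ ℕtoℚ-+ (budget ℕ.+ budget) 1 ⟨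
      ℕtoℚ (budget ℕ.+ budget ℕ.+ 1)                 ∎

    within : ∀ x → expCost (algorithm t) x ≤ ℕtoℚ (t ℕ.* budget ℕ.+ (budget ℕ.+ budget ℕ.+ 1))
    within x = begin
      expCost (algorithm t) x
        ≡⟨ expCost-expect (algorithm t) x ⟩
      expect (algorithm t) (λ T → ℕtoℚ (cost T x))
        ≡⟨ expect-map (λ Ts → run Ts []) (words S (t ℕ.+ n)) (λ T → ℕtoℚ (cost T x)) ⟩
      runCost (t ℕ.+ n) x []
        ≤⟨ runCost-decay t n x [] ⟩
      ℕtoℚ (t ℕ.* budget) + decay t * slope n * potential x []
        ≡⟨ cong (_+_ (ℕtoℚ (t ℕ.* budget))) (lemma (decay t) (slope n) (potential x [])) ⟩
      ℕtoℚ (t ℕ.* budget) + slope n * (decay t * potential x [])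
        ≤⟨ +-monoʳ-≤ (ℕtoℚ (t ℕ.* budget)) (*-monoˡ (0≤slope n)
             (decay-≤2^ t (≤-trans (potential≤reach^reach x []) (ℕtoℚ-mono reach^reach≤2^t)))) ⟩
      ℕtoℚ (t ℕ.* budget) + slope n * 1ℚ
        ≡⟨ cong (_+_ (ℕtoℚ (t ℕ.* budget))) (*-identityʳ (slope n)) ⟩
      ℕtoℚ (t ℕ.* budget) + slope n
        ≤⟨ +-monoʳ-≤ (ℕtoℚ (t ℕ.* budget)) slope≤ ⟩
      ℕtoℚ (t ℕ.* budget) + ℕtoℚ (budget ℕ.+ budget ℕ.+ 1)
        ≡⟨ ℕtoℚ-+ (t ℕ.* budget) (budget ℕ.+ budget ℕ.+ 1) ⟨
      ℕtoℚ (t ℕ.* budget ℕ.+ (budget ℕ.+ budget ℕ.+ 1)) ∎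
      where
      lemma : ∀ d s p → d * s * p ≡ s * (d * p)
      lemma = solve-∀ ℚ-ring

-- Logarithms and the number of rounds

-- The induction follows the recursion of `⌈log2⌉`; the accessibility proof is arbitrary so that the
-- one in the recursive call is covered.
n≤2^⌈log2⌉ : ∀ n (a : Acc ℕ._<_ n) → n ℕ.≤ 2 ℕ.^ ⌈log2⌉ n a
n≤2^⌈log2⌉ zero          _        = z≤n
n≤2^⌈log2⌉ (suc zero)    _        = s≤s z≤n
n≤2^⌈log2⌉ (suc (suc n)) (acc rs) = begin
  2 ℕ.+ n                                   ≡⟨ cong (2 ℕ.+_) (ℕ.⌊n/2⌋+⌈n/2⌉≡n n) ⟨
  2 ℕ.+ (ℕ.⌊ n /2⌋ ℕ.+ ℕ.⌈ n /2⌉)           ≤⟨ ℕ.+-monoʳ-≤ 2 (ℕ.+-monoˡ-≤ ℕ.⌈ n /2⌉ (ℕ.⌊n/2⌋≤⌈n/2⌉ n)) ⟩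
  2 ℕ.+ (ℕ.⌈ n /2⌉ ℕ.+ ℕ.⌈ n /2⌉)           ≡⟨ lemma ℕ.⌈ n /2⌉ ⟩
  2 ℕ.* suc ℕ.⌈ n /2⌉                       ≤⟨ ℕ.*-monoʳ-≤ 2 (n≤2^⌈log2⌉ (suc ℕ.⌈ n /2⌉) _) ⟩
  2 ℕ.^ ⌈log2⌉ (suc (suc n)) (acc rs)       ∎
  where
  open ℕ.≤-Reasoning
  lemma : ∀ h → 2 ℕ.+ (h ℕ.+ h) ≡ 2 ℕ.* suc h
  lemma = ℕ-solve-∀

n≤2^⌈log₂n⌉ : ∀ n → n ℕ.≤ 2 ℕ.^ ⌈log₂ n ⌉
n≤2^⌈log₂n⌉ n = n≤2^⌈log2⌉ n (<-wellFounded n)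

-- The number `reach`, that is `4c`, is at most 2 to the power `2 + ⌈log₂ c ⌉`. Raising it to the
-- power `reach` multiplies this exponent by `reach`.
rounds : ℕ → ℕ
rounds c = 2 ℕ.* (c ℕ.+ c) ℕ.* (2 ℕ.+ ⌈log₂ c ⌉)

reach^reach≤2^rounds : ∀ c → (2 ℕ.* (c ℕ.+ c)) ℕ.^ (2 ℕ.* (c ℕ.+ c)) ℕ.≤ 2 ℕ.^ rounds c
reach^reach≤2^rounds c = begin
  m ℕ.^ m                           ≤⟨ ℕ.^-monoˡ-≤ m m≤ ⟩
  (2 ℕ.^ (2 ℕ.+ ⌈log₂ c ⌉)) ℕ.^ m   ≡⟨ ℕ.^-*-assoc 2 (2 ℕ.+ ⌈log₂ c ⌉) m ⟩
  2 ℕ.^ ((2 ℕ.+ ⌈log₂ c ⌉) ℕ.* m)   ≡⟨ cong (2 ℕ.^_) (ℕ.*-comm (2 ℕ.+ ⌈log₂ c ⌉) m) ⟩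
  2 ℕ.^ rounds c                    ∎
  where
  open ℕ.≤-Reasoning
  m : ℕ
  m = 2 ℕ.* (c ℕ.+ c)

  lemma : ∀ c → 2 ℕ.* (c ℕ.+ c) ≡ 2 ℕ.* (2 ℕ.* c)
  lemma = ℕ-solve-∀

  m≤ : m ℕ.≤ 2 ℕ.^ (2 ℕ.+ ⌈log₂ c ⌉)
  m≤ = ℕ.≤-trans (ℕ.≤-reflexive (lemma c)) (ℕ.*-monoʳ-≤ 2 (ℕ.*-monoʳ-≤ 2 (n≤2^⌈log₂n⌉ c)))

-- With `l` the logarithm, the left side is `16c² + 8c²l + 4c + 1`. For `c ≥ 1` the terms without
-- `l` are at most `(16 + 4 + 1)c²`, whence 21.
rounds-bound : ∀ c {{_ : ℕ.NonZero c}} →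
  rounds c ℕ.* (c ℕ.+ c) ℕ.+ (c ℕ.+ c ℕ.+ (c ℕ.+ c) ℕ.+ 1) ℕ.≤ 21 ℕ.* (c ℕ.* c ℕ.* suc ⌈log₂ c ⌉)
rounds-bound (suc a) = ℕ.≤-trans (ℕ.m≤m+n _ _) (ℕ.≤-reflexive (sym (lemma a ⌈log₂ suc a ⌉)))
  where
  -- Writing `c` as `suc a` makes the difference of the two sides a polynomial with natural
  -- coefficients.
  lemma : ∀ a l → 21 ℕ.* (suc a ℕ.* suc a ℕ.* suc l) ≡
    2 ℕ.* (suc a ℕ.+ suc a) ℕ.* (2 ℕ.+ l) ℕ.* (suc a ℕ.+ suc a) ℕ.+ (suc a ℕ.+ suc a ℕ.+ (suc a ℕ.+ suc a) ℕ.+ 1) ℕ.+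
    (6 ℕ.* a ℕ.+ 5 ℕ.* a ℕ.* a ℕ.+ 13 ℕ.* l ℕ.* suc a ℕ.* suc a)
  lemma = ℕ-solve-∀

-- Rounding of rationals

floor-bounds : ∀ q → (floor q ℤ.* ↧ q ℤ.≤ ↥ q) × (↥ q ℤ.≤ floor q ℤ.* ↧ q ℤ.+ ↧ q)
floor-bounds q@record{} = ℤ.[n/d]*d≤n (↥ q) (↧ q) , (begin
  ↥ q                                      ≡⟨ ℤ.a≡a%n+[a/n]*n (↥ q) (↧ q) ⟩
  + (↥ q ℤ.% ↧ q) ℤ.+ floor q ℤ.* ↧ q      ≤⟨ ℤ.+-monoˡ-≤ (floor q ℤ.* ↧ q) (ℤ.+≤+ (ℕ.<⇒≤ (ℤ.n%d<d (↥ q) (↧ q)))) ⟩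
  ↧ q ℤ.+ floor q ℤ.* ↧ q                  ≡⟨ ℤ.+-comm (↧ q) (floor q ℤ.* ↧ q) ⟩
  floor q ℤ.* ↧ q ℤ.+ ↧ q                  ∎)
  where open ℤ.≤-Reasoning

ceiling-bounds : ∀ q → (↥ q ℤ.≤ ceiling q ℤ.* ↧ q) × (ceiling q ℤ.* ↧ q ℤ.≤ ↥ q ℤ.+ ↧ q)
-- Matching on the record lets `ceiling q` unfold to the negated floor of `- q`, whose two bounds
-- yield these with their roles exchanged.
ceiling-bounds q@record{} = low , high
  where
  open ℤ.≤-Reasoning
  F : ℤ
  F = floor (- q)

  lower : F ℤ.* ↧ q ℤ.≤ ℤ.- ↥ q
  lower = subst₂ (λ d n → F ℤ.* d ℤ.≤ n) (↧-neg q) (↥-neg q) (proj₁ (floor-bounds (- q)))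

  upper : ℤ.- ↥ q ℤ.≤ F ℤ.* ↧ q ℤ.+ ↧ q
  upper = subst₂ (λ d n → n ℤ.≤ F ℤ.* d ℤ.+ d) (↧-neg q) (↥-neg q) (proj₂ (floor-bounds (- q)))

  low : ↥ q ℤ.≤ ceiling q ℤ.* ↧ q
  low = begin
    ↥ q                        ≡⟨ ℤ.neg-involutive (↥ q) ⟨
    ℤ.- ℤ.- ↥ q                ≤⟨ ℤ.neg-mono-≤ lower ⟩
    ℤ.- (F ℤ.* ↧ q)            ≡⟨ ℤ.neg-distribˡ-* F (↧ q) ⟩
    ceiling q ℤ.* ↧ q          ∎

  high : ceiling q ℤ.* ↧ q ℤ.≤ ↥ q ℤ.+ ↧ q
  high = begin
    ℤ.- F ℤ.* ↧ q                                ≡⟨ lemma F (↥ q) (↧ q) ⟩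
    ℤ.- ↥ q ℤ.+ (↥ q ℤ.- F ℤ.* ↧ q)              ≤⟨ ℤ.+-monoˡ-≤ (↥ q ℤ.- F ℤ.* ↧ q) upper ⟩
    F ℤ.* ↧ q ℤ.+ ↧ q ℤ.+ (↥ q ℤ.- F ℤ.* ↧ q)    ≡⟨ lemma′ F (↥ q) (↧ q) ⟩
    ↥ q ℤ.+ ↧ q                                  ∎
    where
    lemma : ∀ f n d → ℤ.- f ℤ.* d ≡ ℤ.- n ℤ.+ (n ℤ.- f ℤ.* d)
    lemma = ℤ-solve-∀
    lemma′ : ∀ f n d → f ℤ.* d ℤ.+ d ℤ.+ (n ℤ.- f ℤ.* d) ≡ n ℤ.+ d
    lemma′ = ℤ-solve-∀

module _ {q} (0≤q : 0ℚ ≤ q) where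

  -- A nonnegative number has a nonnegative ceiling, so the absolute value in `r²logr` changes
  -- nothing.
  +∣ceiling∣ : + ∣ ceiling q ∣ ≡ ceiling q
  +∣ceiling∣ = ℤ.0≤i⇒+∣i∣≡i (ℤ.*-cancelʳ-≤-pos (+ 0) (ceiling q) (↧ q) {{↧-pos q}}
    (ℤ.≤-trans (ℤ.≤-trans (drop-*≤* 0≤q) (ℤ.≤-reflexive (ℤ.*-identityʳ (↥ q)))) (proj₁ (ceiling-bounds q))))
    where
    ↧-pos : ∀ q → ℤ.Positive (↧ q)
    ↧-pos record{} = _

  ≤∣ceiling∣ : q ≤ ℕtoℚ ∣ ceiling q ∣
  ≤∣ceiling∣ = toℚᵘ-cancel-≤ (ℚᵘ.≤-respʳ-≃ (ℚᵘ.≃-sym (toℚᵘ-ℕtoℚ ∣ ceiling q ∣)) (ℚᵘ.*≤* (begin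
    ℚᵘ.↥ toℚᵘ q ℤ.* + 1                    ≡⟨ ℤ.*-identityʳ _ ⟩
    ℚᵘ.↥ toℚᵘ q                            ≡⟨ ↥ᵘ-toℚᵘ q ⟩
    ↥ q                                    ≤⟨ proj₁ (ceiling-bounds q) ⟩
    ceiling q ℤ.* ↧ q                      ≡⟨ cong₂ ℤ._*_ +∣ceiling∣ (↧ᵘ-toℚᵘ q) ⟨
    + ∣ ceiling q ∣ ℤ.* ℚᵘ.↧ toℚᵘ q        ∎)))
    where open ℤ.≤-Reasoning

  ∣ceiling∣≤+1 : ℕtoℚ ∣ ceiling q ∣ ≤ q + 1ℚ
  ∣ceiling∣≤+1 = toℚᵘ-cancel-≤ (ℚᵘ.≤-respˡ-≃ (ℚᵘ.≃-sym (toℚᵘ-ℕtoℚ ∣ ceiling q ∣))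
    (ℚᵘ.≤-respʳ-≃ (ℚᵘ.≃-sym (toℚᵘ-homo-+ q 1ℚ)) (ℚᵘ.*≤* (below q +∣ceiling∣ (proj₂ (ceiling-bounds q))))))
    where
    open ℤ.≤-Reasoning
    below : ∀ q → + ∣ ceiling q ∣ ≡ ceiling q → ceiling q ℤ.* ↧ q ℤ.≤ ↥ q ℤ.+ ↧ q →
      + ∣ ceiling q ∣ ℤ.* ℚᵘ.↧ (toℚᵘ q ℚᵘ.+ ℚᵘ.1ℚᵘ) ℤ.≤ ℚᵘ.↥ (toℚᵘ q ℚᵘ.+ ℚᵘ.1ℚᵘ) ℤ.* + 1
    below q@(mkℚ N d-1 _) abs high = begin
      + ∣ ceiling q ∣ ℤ.* (↧ q ℤ.* + 1)         ≡⟨ cong₂ ℤ._*_ abs (ℤ.*-identityʳ (↧ q)) ⟩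
      ceiling q ℤ.* ↧ q                         ≤⟨ high ⟩
      ↥ q ℤ.+ ↧ q                               ≡⟨ lemma (↥ q) (↧ q) ⟩
      (↥ q ℤ.* + 1 ℤ.+ + 1 ℤ.* ↧ q) ℤ.* + 1     ∎
      where
      lemma : ∀ n d → n ℤ.+ d ≡ (n ℤ.* + 1 ℤ.+ + 1 ℤ.* d) ℤ.* + 1
      lemma = ℤ-solve-∀

-- The final constant and the constant functions

-- As `r` is at least 1, rounding it up at most doubles it. Squaring then costs a factor 4, and 84
-- is 4 times 21; the logarithmic factor is already that of `r²logr`.
cost-bound≤ : ∀ {r} → 1ℚ ≤ r → (c≢0 : ℕ.NonZero ∣ ceiling r ∣) → let c = ∣ ceiling r ∣ in
  ℕtoℚ (rounds c ℕ.* (c ℕ.+ c) ℕ.+ (c ℕ.+ c ℕ.+ (c ℕ.+ c) ℕ.+ 1)) ≤ ℕtoℚ 84 * r²logr r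
cost-bound≤ {r} 1≤r c≢0 = begin
  ℕtoℚ (rounds c ℕ.* (c ℕ.+ c) ℕ.+ (c ℕ.+ c ℕ.+ (c ℕ.+ c) ℕ.+ 1))
    ≤⟨ ℕtoℚ-mono (rounds-bound c {{c≢0}}) ⟩
  ℕtoℚ (21 ℕ.* (c ℕ.* c ℕ.* L))
    ≡⟨ trans (ℕtoℚ-* 21 (c ℕ.* c ℕ.* L)) (cong (ℕtoℚ 21 *_) (trans (ℕtoℚ-* (c ℕ.* c) L) (cong (_* ℕtoℚ L) (ℕtoℚ-* c c)))) ⟩
  ℕtoℚ 21 * (ℕtoℚ c * ℕtoℚ c * ℕtoℚ L)
    ≤⟨ *-monoˡ (0≤ℕtoℚ 21) (*-monoʳ (0≤ℕtoℚ L) (≤-trans (*-monoˡ (0≤ℕtoℚ c) c≤2r) (*-monoʳ 0≤2r c≤2r))) ⟩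
  ℕtoℚ 21 * (ℕtoℚ 2 * r * (ℕtoℚ 2 * r) * ℕtoℚ L)
    ≡⟨ lemma (ℕtoℚ 21) (ℕtoℚ 2) r (ℕtoℚ L) ⟩
  ℕtoℚ 21 * (ℕtoℚ 2 * ℕtoℚ 2) * (r * r * ℕtoℚ L)
    ≡⟨⟩
  ℕtoℚ 84 * r²logr r ∎
  where
  open ≤-Reasoning
  c L : ℕ
  c = ∣ ceiling r ∣
  L = suc ⌈log₂ c ⌉

  0≤r : 0ℚ ≤ r
  0≤r = ≤-trans 0≤1 1≤r

  0≤2r : 0ℚ ≤ ℕtoℚ 2 * r
  0≤2r = 0≤* (0≤ℕtoℚ 2) 0≤r

  lemma : ∀ a b r l → a * (b * r * (b * r) * l) ≡ a * (b * b) * (r * r * l)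
  lemma = solve-∀ ℚ-ring

  c≤2r : ℕtoℚ c ≤ ℕtoℚ 2 * r
  c≤2r = begin
    ℕtoℚ c               ≤⟨ ∣ceiling∣≤+1 0≤r ⟩
    r + 1ℚ               ≤⟨ +-monoʳ-≤ r 1≤r ⟩
    r + r                ≡⟨ cong₂ _+_ (*-identityˡ r) (*-identityˡ r) ⟨
    1ℚ * r + 1ℚ * r      ≡⟨ *-distribʳ-+ r 1ℚ 1ℚ ⟨
    ℕtoℚ 2 * r           ∎

constant-within : ∀ {n} (f : Vec Bool n → Bool) {b} → (∀ x → f x ≡ b) → ∀ {q} → 0ℚ ≤ q →
  ZeroErrorAlgWithin (totalSpec f) (dirac (leaf b)) q
constant-within f f≡b 0≤q =
  (0≤1 ∷ [] , refl) , ((λ x b fx≡b → trans (sym (f≡b x)) fx≡b) ∷ []) , λ _ _ _ → 0≤q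

-- For constant `f` the sabotage problem has empty domain, so `r` may be negative; the bound is
-- still nonnegative because `r` enters its leading factor squared.
0≤square : ∀ q → 0ℚ ≤ q * q
0≤square q with ≤-total 0ℚ q
... | inj₁ 0≤q = 0≤* 0≤q 0≤q
... | inj₂ q≤0 = ≤-trans (0≤* 0≤-q 0≤-q) (≤-reflexive (lemma q))
  where
  0≤-q : 0ℚ ≤ - q
  0≤-q = neg-antimono-≤ q≤0
  lemma : ∀ q → - q * - q ≡ q * q
  lemma = solve-∀ ℚ-ring

theorem32 : ∃ λ (C : ℕ) → ∀ (n : ℕ) (f : Vec Bool n → Bool)
    (S : RandAlg Σ₄ n) (r : ℚ) →
    ZeroErrorAlgWithin (sabSpec f) S r →
    ∃ λ (R : RandAlg Bool n) →
    ZeroErrorAlgWithin (totalSpec f) R (ℕtoℚ C * r²logr r)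
theorem32 = 84 , prove
  where
  prove : ∀ (n : ℕ) (f : Vec Bool n → Bool) (S : RandAlg Σ₄ n) (r : ℚ) →
    ZeroErrorAlgWithin (sabSpec f) S r →
    ∃ λ (R : RandAlg Bool n) → ZeroErrorAlgWithin (totalSpec f) R (ℕtoℚ 84 * r²logr r)
  -- The all-`true` vector is an arbitrary reference point. An input of different value yields
  -- `1ℚ ≤ r`; if there is none, `f` is constant and a leaf suffices.
  prove n f S r sab with anyVec? (λ z → ¬? (f z Bool.≟ f (replicate n true)))
  ... | no constant = _ , constant-within f
    (λ x → decidable-stable (f x Bool.≟ f (replicate n true)) (λ ne → constant (x , ne)))
    (0≤* (0≤ℕtoℚ 84) (0≤* (0≤square r) (0≤ℕtoℚ (suc ⌈log₂ ∣ ceiling r ∣ ⌉))))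
  ... | yes (z , fz≢) = Algorithm.algorithm f sab c {{c≢0}} r≤c (rounds c) , proj₁ within , proj₁ (proj₂ within) ,
    λ x b fx≡b → ≤-trans (proj₂ (proj₂ within) x b fx≡b) (cost-bound≤ 1≤r c≢0)
    where
    c : ℕ
    c = ∣ ceiling r ∣

    1≤r : 1ℚ ≤ r
    1≤r = Sabotage.1≤r f sab fz≢

    r≤c : r ≤ ℕtoℚ c
    r≤c = ≤∣ceiling∣ (≤-trans 0≤1 1≤r)

    c≢0 : ℕ.NonZero c
    c≢0 = ℕ.>-nonZero (ℕtoℚ-cancel-≤ {1} (≤-trans 1≤r r≤c))

    within = Algorithm.algorithm-within f sab c {{c≢0}} r≤c (rounds c) (reach^reach≤2^rounds c)
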